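{- Let $r\ge 1$ be an integer and let $G$ be a finite simple connected graph with $m$ edges, where $m \geq (9r)^2$. Suppose that $G$ is $B_{r+1}$-free. Then $$\rho(G) \leq \sqrt{m},$$ with equality if and only if $G$ is a complete bipartite graph.
   Context: All graphs are finite, simple and connected, and have no isolated vertices. For a graph $G$, $\rho(G)$ denotes its spectral radius, i.e. the largest eigenvalue of its adjacency matrix. For an integer $k\ge 1$, the book of size $k$, denoted $B_k$, is the graph formed by $k$ triangles sharing a common edge (so $B_k$ has $k+2$ vertices and $2k+1$ edges). A graph is $B_k$-free if it does not contain $B_k$ as a (not necessarily induced) subgraph. -}

module Defs where

open import Algebra.Bundles using (RawMonoid)
import Algebra.Definitions.RawMonoid as RawMonoidDefs
open import Data.Bool using (Bool; if_then_else_)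
open import Data.Fin as Fin using (Fin; toℕ)
import Data.Fin.Properties as Fin
import Data.Integer as ℤ
open import Data.List using (List; allFin; cartesianProduct; filter; length)
open import Data.Nat as ℕ using (ℕ; _⊔_)
import Data.Nat.Properties as ℕ
open import Data.Product using (_×_; _,_; ∃; ∃-syntax)
open import Data.Rational as ℚ using (ℚ; 0ℚ; 1ℚ; ½; ∣_∣)
import Data.Rational.Properties as ℚ
open import Data.Rational.Solver using (module +-*-Solver)
open import Data.Sum using (_⊎_; swap)
open import Function using (_∘_)
open import Function.Bundles using (_⇔_)
open import Function.Definitions using (Injective; Surjective)
open import Level using (0ℓ)
open import Relation.Binary using (Rel; Symmetric; Irreflexive; Decidable)
open import Relation.Binary.Construct.Closure.ReflexiveTransitive using (Star)
open import Relation.Binary.PropositionalEquality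
  using (_≡_; _≢_; refl; sym; cong; subst; module ≡-Reasoning)
open import Relation.Nullary using (¬_; does; ¬?; _×-dec_; _⊎-dec_)

-- Real numbers: Cauchy sequences of rationals, up to _≃_.  All operations
-- are pointwise.
IsCauchy : (ℕ → ℚ) → Set
IsCauchy s = ∀ ε → 0ℚ ℚ.< ε →
  ∃[ N ] (∀ m n → N ℕ.≤ m → N ℕ.≤ n → ∣ s m ℚ.- s n ∣ ℚ.< ε)

record ℝ : Set where
  constructor mkℝ
  field
    seq    : ℕ → ℚ
    cauchy : IsCauchy seq

open ℝ public

infix 4 _≃_ _≤_

_≃_ : Rel ℝ 0ℓ
x ≃ y = ∀ ε → 0ℚ ℚ.< ε →
  ∃[ N ] (∀ n → N ℕ.≤ n → ∣ seq x n ℚ.- seq y n ∣ ℚ.< ε)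

_≤_ : Rel ℝ 0ℓ
x ≤ y = ∀ ε → 0ℚ ℚ.< ε →
  ∃[ N ] (∀ n → N ℕ.≤ n → seq x n ℚ.< seq y n ℚ.+ ε)

fromℚ : ℚ → ℝ
fromℚ q = mkℝ (λ _ → q) λ ε 0<ε →
  0 , λ _ _ _ _ → subst (λ d → ∣ d ∣ ℚ.< ε) (sym (ℚ.+-inverseʳ q)) 0<ε

fromℕ : ℕ → ℝ
fromℕ n = fromℚ (ℤ.+ n ℚ./ 1)

0ℝ 1ℝ : ℝ
0ℝ = fromℚ 0ℚ
1ℝ = fromℚ 1ℚ

module _ where
  open +-*-Solver

  +-difference : ∀ a b c d →
    (a ℚ.+ b) ℚ.- (c ℚ.+ d) ≡ (a ℚ.- c) ℚ.+ (b ℚ.- d)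
  +-difference = solve 4 (λ a b c d →
    (a :+ b) :- (c :+ d) := (a :- c) :+ (b :- d)) refl

  *-difference : ∀ a b c d →
    a ℚ.* b ℚ.- c ℚ.* d ≡ a ℚ.* (b ℚ.- d) ℚ.+ d ℚ.* (a ℚ.- c)
  *-difference = solve 4 (λ a b c d →
    a :* b :- c :* d := a :* (b :- d) :+ d :* (a :- c)) refl

  +-recover : ∀ a b → a ≡ b ℚ.+ (a ℚ.- b)
  +-recover = solve 2 (λ a b → a := b :+ (a :- b)) refl

½>0 : ∀ {ε} → 0ℚ ℚ.< ε → 0ℚ ℚ.< ½ ℚ.* ε
½>0 {ε} 0<ε = ℚ.positive⁻¹ _ {{ℚ.pos*pos⇒pos ½ ε {{ℚ.positive 0<ε}}}}

sum-cauchy : ∀ s t → IsCauchy s → IsCauchy t →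
             IsCauchy (λ n → s n ℚ.+ t n)
sum-cauchy s t cs ct ε 0<ε with cs _ (½>0 0<ε) | ct _ (½>0 0<ε)
... | M , sM | N , tN = M ⊔ N , λ m n m≥ n≥ → begin-strict
  ∣ (s m ℚ.+ t m) ℚ.- (s n ℚ.+ t n) ∣
    ≡⟨ cong ∣_∣ (+-difference (s m) (t m) (s n) (t n)) ⟩
  ∣ (s m ℚ.- s n) ℚ.+ (t m ℚ.- t n) ∣
    ≤⟨ ℚ.∣p+q∣≤∣p∣+∣q∣ (s m ℚ.- s n) (t m ℚ.- t n) ⟩
  ∣ s m ℚ.- s n ∣ ℚ.+ ∣ t m ℚ.- t n ∣
    <⟨ ℚ.+-mono-<
         (sM m n (ℕ.m⊔n≤o⇒m≤o M N m≥) (ℕ.m⊔n≤o⇒m≤o M N n≥))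
         (tN m n (ℕ.m⊔n≤o⇒n≤o M N m≥) (ℕ.m⊔n≤o⇒n≤o M N n≥)) ⟩
  ½ ℚ.* ε ℚ.+ ½ ℚ.* ε
    ≡⟨ sym (ℚ.*-distribʳ-+ ε ½ ½) ⟩
  1ℚ ℚ.* ε
    ≡⟨ ℚ.*-identityˡ ε ⟩
  ε ∎
  where
  open ℚ.≤-Reasoning

bounded : ∀ {s} → IsCauchy s →
  ∃[ B ] (ℚ.Positive B × ∃[ N ] (∀ n → N ℕ.≤ n → ∣ s n ∣ ℚ.≤ B))
bounded {s} cs with cs 1ℚ (ℚ.positive⁻¹ 1ℚ)
... | N , sN = ∣ s N ∣ ℚ.+ 1ℚ
  , ℚ.nonNeg+pos⇒pos ∣ s N ∣ {{ℚ.nonNegative (ℚ.0≤∣p∣ (s N))}} 1ℚ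
  , N , λ n n≥ → begin
    ∣ s n ∣
      ≡⟨ cong ∣_∣ (+-recover (s n) (s N)) ⟩
    ∣ s N ℚ.+ (s n ℚ.- s N) ∣
      ≤⟨ ℚ.∣p+q∣≤∣p∣+∣q∣ (s N) (s n ℚ.- s N) ⟩
    ∣ s N ∣ ℚ.+ ∣ s n ℚ.- s N ∣
      ≤⟨ ℚ.+-monoʳ-≤ ∣ s N ∣ (ℚ.<⇒≤ (sN n N n≥ ℕ.≤-refl)) ⟩
    ∣ s N ∣ ℚ.+ 1ℚ ∎
  where
  open ℚ.≤-Reasoning

∣p*q∣<C*δ : ∀ C .{{_ : ℚ.Positive C}} {δ} p q →
            ∣ p ∣ ℚ.≤ C → ∣ q ∣ ℚ.< δ → ∣ p ℚ.* q ∣ ℚ.< C ℚ.* δ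
∣p*q∣<C*δ C {δ} p q p≤ q< = begin-strict
  ∣ p ℚ.* q ∣
    ≡⟨ ℚ.∣p*q∣≡∣p∣*∣q∣ p q ⟩
  ∣ p ∣ ℚ.* ∣ q ∣
    ≤⟨ ℚ.*-monoʳ-≤-nonNeg ∣ q ∣ {{ℚ.nonNegative (ℚ.0≤∣p∣ q)}} p≤ ⟩
  C ℚ.* ∣ q ∣
    <⟨ ℚ.*-monoʳ-<-pos C q< ⟩
  C ℚ.* δ ∎
  where open ℚ.≤-Reasoning

product-close : ∀ A B .{{_ : ℚ.Positive A}} .{{_ : ℚ.Positive B}} δ a b c d →
  ∣ a ∣ ℚ.≤ A → ∣ d ∣ ℚ.≤ B → ∣ a ℚ.- c ∣ ℚ.< δ → ∣ b ℚ.- d ∣ ℚ.< δ →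
  ∣ a ℚ.* b ℚ.- c ℚ.* d ∣ ℚ.< (A ℚ.+ B) ℚ.* δ
product-close A B δ a b c d a≤ d≤ a-c< b-d< = begin-strict
  ∣ a ℚ.* b ℚ.- c ℚ.* d ∣
    ≡⟨ cong ∣_∣ (*-difference a b c d) ⟩
  ∣ a ℚ.* (b ℚ.- d) ℚ.+ d ℚ.* (a ℚ.- c) ∣
    ≤⟨ ℚ.∣p+q∣≤∣p∣+∣q∣ (a ℚ.* (b ℚ.- d)) (d ℚ.* (a ℚ.- c)) ⟩
  ∣ a ℚ.* (b ℚ.- d) ∣ ℚ.+ ∣ d ℚ.* (a ℚ.- c) ∣
    <⟨ ℚ.+-mono-< (∣p*q∣<C*δ A a (b ℚ.- d) a≤ b-d<)
                  (∣p*q∣<C*δ B d (a ℚ.- c) d≤ a-c<) ⟩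
  A ℚ.* δ ℚ.+ B ℚ.* δ
    ≡⟨ ℚ.*-distribʳ-+ δ A B ⟨
  (A ℚ.+ B) ℚ.* δ ∎
  where open ℚ.≤-Reasoning

divide : ∀ C .{{_ : ℚ.Positive C}} ε → 0ℚ ℚ.< ε →
         ∃[ δ ] (0ℚ ℚ.< δ × C ℚ.* δ ≡ ε)
divide C ε 0<ε = 1/C ℚ.* ε , 0<δ , (begin
  C ℚ.* (1/C ℚ.* ε)  ≡⟨ ℚ.*-assoc C 1/C ε ⟨
  (C ℚ.* 1/C) ℚ.* ε  ≡⟨ cong (ℚ._* ε) (ℚ.*-inverseʳ C {{C≢0}}) ⟩
  1ℚ ℚ.* ε           ≡⟨ ℚ.*-identityˡ ε ⟩
  ε                  ∎)
  where
  open ≡-Reasoning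
  C≢0 : ℚ.NonZero C
  C≢0 = ℚ.pos⇒nonZero C
  1/C : ℚ
  1/C = (ℚ.1/ C) {{C≢0}}
  0<δ : 0ℚ ℚ.< 1/C ℚ.* ε
  0<δ = ℚ.positive⁻¹ (1/C ℚ.* ε)
    {{ℚ.pos*pos⇒pos 1/C {{ℚ.1/pos⇒pos C}} ε {{ℚ.positive 0<ε}}}}

product-cauchy : ∀ s t → IsCauchy s → IsCauchy t →
                 IsCauchy (λ n → s n ℚ.* t n)
product-cauchy s t cs ct ε 0<ε = go (bounded cs) (bounded ct)
  where
  Bound : (ℕ → ℚ) → Set
  Bound u = ∃[ B ] (ℚ.Positive B × ∃[ N ] (∀ n → N ℕ.≤ n → ∣ u n ∣ ℚ.≤ B))

  Close : (ℕ → ℚ) → ℚ → Set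
  Close u δ = ∃[ N ] (∀ m n → N ℕ.≤ m → N ℕ.≤ n → ∣ u m ℚ.- u n ∣ ℚ.< δ)

  close : ((A , _) : Bound s) ((B , _) : Bound t) →
          ∀ δ → Close s δ → Close t δ →
          Close (λ n → s n ℚ.* t n) ((A ℚ.+ B) ℚ.* δ)
  close (A , A>0 , K , sK) (B , B>0 , L , tL) δ (M , sM) (N , tN) =
    (K ⊔ L) ⊔ (M ⊔ N) , λ m n m≥ n≥ →
      product-close A B {{A>0}} {{B>0}} δ (s m) (t m) (s n) (t n)
        (sK m (ℕ.m⊔n≤o⇒m≤o K L (left m≥)))
        (tL n (ℕ.m⊔n≤o⇒n≤o K L (left n≥)))
        (sM m n (ℕ.m⊔n≤o⇒m≤o M N (right m≥)) (ℕ.m⊔n≤o⇒m≤o M N (right n≥)))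
        (tN m n (ℕ.m⊔n≤o⇒n≤o M N (right m≥)) (ℕ.m⊔n≤o⇒n≤o M N (right n≥)))
    where
    left : ∀ {i} → (K ⊔ L) ⊔ (M ⊔ N) ℕ.≤ i → K ⊔ L ℕ.≤ i
    left = ℕ.m⊔n≤o⇒m≤o (K ⊔ L) (M ⊔ N)
    right : ∀ {i} → (K ⊔ L) ⊔ (M ⊔ N) ℕ.≤ i → M ⊔ N ℕ.≤ i
    right = ℕ.m⊔n≤o⇒n≤o (K ⊔ L) (M ⊔ N)

  go : Bound s → Bound t → Close (λ n → s n ℚ.* t n) ε
  go bs@(A , A>0 , _) bt@(B , B>0 , _) = finish (divide (A ℚ.+ B) ε 0<ε)
    where
    instance _ = ℚ.pos+pos⇒pos A {{A>0}} B {{B>0}}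
    finish : ∃[ δ ] (0ℚ ℚ.< δ × (A ℚ.+ B) ℚ.* δ ≡ ε) →
             Close (λ n → s n ℚ.* t n) ε
    finish (δ , 0<δ , eq) = subst (Close (λ n → s n ℚ.* t n)) eq
      (close bs bt δ (cs δ 0<δ) (ct δ 0<δ))

infixl 6 _+_
infixl 7 _*_

_+_ : ℝ → ℝ → ℝ
x + y = mkℝ (λ n → seq x n ℚ.+ seq y n)
            (sum-cauchy (seq x) (seq y) (cauchy x) (cauchy y))

_*_ : ℝ → ℝ → ℝ
x * y = mkℝ (λ n → seq x n ℚ.* seq y n)
            (product-cauchy (seq x) (seq y) (cauchy x) (cauchy y))

+-0-rawMonoid : RawMonoid 0ℓ 0ℓ
+-0-rawMonoid = record { Carrier = ℝ ; _≈_ = _≃_ ; _∙_ = _+_ ; ε = 0ℝ }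

open RawMonoidDefs +-0-rawMonoid public using (sum)

IsSqrt : ℝ → ℝ → Set
IsSqrt x s = 0ℝ ≤ s × s * s ≃ x

Matrix : ℕ → Set
Matrix n = Fin n → Fin n → ℝ

-- Only real eigenvalues are considered; this loses nothing for the symmetric
-- matrices used below.
IsEigenvalue : ∀ {n} → Matrix n → ℝ → Set
IsEigenvalue {n} A μ = ∃ λ (x : Fin n → ℝ) →
  ¬ (∀ i → x i ≃ 0ℝ) × (∀ i → sum (λ j → A i j * x j) ≃ μ * x i)

IsLargestEigenvalue : ∀ {n} → Matrix n → ℝ → Set
IsLargestEigenvalue A ρ =
  IsEigenvalue A ρ × (∀ μ → IsEigenvalue A μ → μ ≤ ρ)

record Graph (n : ℕ) : Set₁ where
  infix 4 _~_ _~?_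
  field
    _~_      : Rel (Fin n) 0ℓ
    _~?_     : Decidable _~_
    ~-sym    : Symmetric _~_
    ~-irrefl : Irreflexive _≡_ _~_

module _ {n : ℕ} (G : Graph n) where
  open Graph G

  -- Each edge is listed once, as the ordered pair with i < j.
  edges : List (Fin n × Fin n)
  edges = filter (λ (i , j) → (i Fin.<? j) ×-dec (i ~? j))
                 (cartesianProduct (allFin n) (allFin n))

  numEdges : ℕ
  numEdges = length edges

  Connected : Set
  Connected = ∀ u v → Star _~_ u v

  adjacencyMatrix : Matrix n
  adjacencyMatrix i j = if does (i ~? j) then 1ℝ else 0ℝ

  IsSpectralRadius : ℝ → Set
  IsSpectralRadius = IsLargestEigenvalue adjacencyMatrix

  -- The two sides are the (nonempty) fibres of the map c.
  CompleteBipartite : Set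
  CompleteBipartite = ∃ λ (c : Fin n → Bool) →
    Surjective _≡_ _≡_ c × (∀ u v → u ~ v ⇔ c u ≢ c v)

-- H is a (not necessarily induced) subgraph of G, up to isomorphism.
_⊑_ : ∀ {k n} → Graph k → Graph n → Set
_⊑_ {k} {n} H G = ∃ λ (f : Fin k → Fin n) →
  Injective _≡_ _≡_ f × (∀ {u v} → u ~ᴴ v → f u ~ᴳ f v)
  where
  open Graph H using () renaming (_~_ to _~ᴴ_)
  open Graph G using () renaming (_~_ to _~ᴳ_)

-- Vertices 0 and 1 span the common edge; the k others are the apexes of
-- the triangles, adjacent to exactly 0 and 1.
book : ∀ k → Graph (2 ℕ.+ k)
book k = record
  { _~_      = λ i j → i ≢ j × (OnSpine i ⊎ OnSpine j)
  ; _~?_     = λ i j → ¬? (i Fin.≟ j) ×-dec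
                       ((toℕ i ℕ.<? 2) ⊎-dec (toℕ j ℕ.<? 2))
  ; ~-sym    = λ (i≢j , s) → i≢j ∘ sym , swap s
  ; ~-irrefl = λ i≡j (i≢j , _) → i≢j i≡j
  }
  where
  OnSpine : Fin (2 ℕ.+ k) → Set
  OnSpine i = toℕ i ℕ.< 2

BookFree : ∀ {n} → ℕ → Graph n → Set
BookFree k G = ¬ (book k ⊑ G)

{-# OPTIONS --safe #-}
module Submission where

-- For an eigenvector z of an eigenvalue ρ ≥ 9r put y = |z|, so that ρ y ≤ A y.  Let ∗ be a vertex
-- where y takes its maximum M, let N be the set of neighbours of ∗ and W the set of the vertices
-- outside N ∪ {∗}.  Comparing edges with walks of length two that start at ∗ gives
--   2 (m − ρ²) M ≥ T − S,   S = 2 Σ_{uv ∈ E(N)} (y u + y v − M),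
-- where T ≥ 0 is a sum of deficits: one for ρ M < Σ_N y, one for every edge inside W, and one for
-- every w ∈ W with y w < M.  A vertex w ∈ W missing a neighbour v ∈ N causes a deficit, so T is at
-- least a multiple of Σ y v y w over the nonadjacent pairs v ∈ N, w ∈ W.  On the other hand the ends
-- of an edge inside N share at most r neighbours, hence together miss almost all of W, and a vertex
-- of N is on at most r such edges.  Altogether 2 T ≥ 3 S, so ρ² ≤ m.  If ρ² = m then S = T = 0, which
-- forces W and N to be independent and completely joined.
--
-- The order of ℝ is total only up to double negation; this suffices, because _≤_ is stable and
-- being complete bipartite is decidable.

open import Algebra.Bundles using (CommutativeRing)
open import Algebra.Solver.Ring.AlmostCommutativeRing
  using (_-Raw-AlmostCommutative⟶_; fromCommutativeRing)
open import Data.Bool as Bool using (Bool; true; false; if_then_else_; not)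
open import Data.Fin as Fin using (Fin; zero; suc)
import Data.Fin.Properties as Fin
open import Data.Integer as ℤ using (ℤ; -[1+_]; _⊖_; _◃_; sign)
import Data.Integer.Properties as ℤ
open import Data.List as List using (List; []; _∷_; _++_; allFin; tabulate; cartesianProduct; filter; length)
open import Data.List.Membership.Propositional.Properties using (∈-lookup)
open import Data.List.Relation.Unary.All as All using (All)
open import Data.List.Relation.Unary.All.Properties using (all-filter)
open import Data.List.Relation.Unary.AllPairs using (_∷_)
open import Data.List.Relation.Unary.Unique.Propositional using (Unique)
import Data.List.Relation.Unary.Unique.Propositional.Properties as Unique
open import Data.Maybe using (Maybe; just; nothing)
open import Data.Nat as ℕ using (ℕ; zero; suc; _⊔_)
open import Data.Nat.Coprimality as Coprimality using (1-coprimeTo)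
import Data.Nat.Properties as ℕ
open import Data.Product using (_×_; _,_; proj₁; proj₂; ∃; ∃-syntax)
open import Data.Rational as ℚ using (ℚ; 0ℚ; 1ℚ; ½; ∣_∣)
import Data.Rational.Properties as ℚ
open import Data.Rational.Solver using (module +-*-Solver)
open import Data.Sign as Sign using (Sign)
open import Data.Sum using (_⊎_; inj₁; inj₂; [_,_]′)
open import Defs using (Graph; Connected; numEdges; edges; CompleteBipartite; BookFree; book; _⊑_)
open import Function using (const; _∘_; id)
open import Function.Bundles using (_⇔_; mk⇔; Equivalence)
open import Function.Definitions using (Injective; Surjective)
open import Level using (0ℓ)
open import Relation.Binary.Construct.Closure.ReflexiveTransitive as Star using (_◅_)
open import Relation.Binary.Definitions using (Tri; tri<; tri≈; tri>)
open import Relation.Binary.PropositionalEquality as ≡ using (_≡_; _≢_)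
open import Relation.Nullary using (¬_; Dec; yes; no; does; contradiction; _×-dec_; ¬?)
open import Relation.Nullary.Decidable using (dec-true; dec-false; decidable-stable; _→-dec_)
open import Relation.Unary using (Decidable)

-- `T` and `S` cannot be compared term by term; both are measured against `Z`, the weight of the
-- nonadjacent pairs between `N` and `W`. With `X` the weight of `W` and `D = X + 2ρM`, the two
-- halves are `D T ≥ 2ρ Z` and `3r D S ≤ 4ρ r Z`. The factor `D` is fitted to the two kinds of
-- deficit: the loss `E` at the centre and the loss `KP` over `W` satisfy `Z ≤ X E + M KP`, and
-- `D (2ρ E + KP)` dominates `2ρ` times the right side. The ratio 3/2 between `T` and `S`, where 1
-- would give the inequality, is for the equality case: `3 (T − S) = T + (2T − 3S)`, so `T = S`
-- forces `T = 0`. The constant 9 pays for this ratio. An edge inside `N` with nonnegative surplus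
-- forces `X ≥ (ρ − 4r) M`, and what is needed is `2ρ (X − rM) ≥ 3r (X + 2ρM)`. For `ρ = 9r`,
-- `X = 5rM` this reads 72 ≥ 69; for `ρ = 8r`, `X = 4rM` it would read 48 ≥ 60. All this happens in
-- an abstract ordered ring, where cancelling a positive factor replaces division.

-- Polynomial identities with integer coefficients in a commutative ring.

module IntegerSolver (R : CommutativeRing 0ℓ 0ℓ) where
  open CommutativeRing R
  open import Algebra.Properties.Ring ring
    using (-‿distribˡ-*; -0#≈0#; -‿involutive)
  open import Algebra.Properties.AbelianGroup +-abelianGroup using (⁻¹-∙-comm)
  open import Algebra.Properties.Semiring.Mult.TCOptimised semiring
    using (1+×; ×-homo-+; ×1-homo-*) renaming (_×_ to _×ʳ_)
  open import Relation.Binary.Reasoning.Setoid setoid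

  ι : ℕ → Carrier
  ι n = n ×ʳ 1#

  ⟦_⟧ : ℤ → Carrier
  ⟦ ℤ.+ n ⟧    = ι n
  ⟦ -[1+ n ] ⟧ = - ι (suc n)

  -- Integer multiplication is defined through sign and absolute value, so multiplicativity of `⟦_⟧`
  -- is proved by splitting images in the same way.
  ⟦⟧-◃ : ∀ s n → ⟦ s ◃ n ⟧ ≈ ⟦ s ◃ 1 ⟧ * ι n
  ⟦⟧-◃ Sign.+ zero    = sym (zeroʳ _)
  ⟦⟧-◃ Sign.- zero    = sym (zeroʳ _)
  ⟦⟧-◃ Sign.+ (suc n) = sym (*-identityˡ _)
  ⟦⟧-◃ Sign.- (suc n) = trans (-‿cong (sym (*-identityˡ _))) (-‿distribˡ-* 1# _)

  ⟦⟧-sign : ∀ s t → ⟦ (s Sign.* t) ◃ 1 ⟧ ≈ ⟦ s ◃ 1 ⟧ * ⟦ t ◃ 1 ⟧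
  ⟦⟧-sign Sign.+ t = sym (*-identityˡ _)
  ⟦⟧-sign Sign.- Sign.+ = sym (*-identityʳ _)
  ⟦⟧-sign Sign.- Sign.- = begin
    1#           ≈⟨ -‿involutive 1# ⟨
    - (- 1#)     ≈⟨ -‿cong (*-identityˡ _) ⟨
    - (1# * - 1#) ≈⟨ -‿distribˡ-* 1# (- 1#) ⟩
    - 1# * - 1#  ∎

  ⟦⟧-◃-sign : ∀ i → ⟦ i ⟧ ≈ ⟦ sign i ◃ 1 ⟧ * ι ℤ.∣ i ∣
  ⟦⟧-◃-sign i = trans (reflexive (≡.cong ⟦_⟧ (≡.sym (ℤ.signᵢ◃∣i∣≡i i))))
                      (⟦⟧-◃ (sign i) ℤ.∣ i ∣)

  ⟦⟧-*-homo : ∀ i j → ⟦ i ℤ.* j ⟧ ≈ ⟦ i ⟧ * ⟦ j ⟧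
  ⟦⟧-*-homo i j = begin
    ⟦ i ℤ.* j ⟧
      ≈⟨ ⟦⟧-◃ (sign i Sign.* sign j) (ℤ.∣ i ∣ ℕ.* ℤ.∣ j ∣) ⟩
    ⟦ (sign i Sign.* sign j) ◃ 1 ⟧ * ι (ℤ.∣ i ∣ ℕ.* ℤ.∣ j ∣)
      ≈⟨ *-cong (⟦⟧-sign (sign i) (sign j)) (×1-homo-* ℤ.∣ i ∣ ℤ.∣ j ∣) ⟩
    (⟦ sign i ◃ 1 ⟧ * ⟦ sign j ◃ 1 ⟧) * (ι ℤ.∣ i ∣ * ι ℤ.∣ j ∣)
      ≈⟨ interchange _ _ _ _ ⟩
    (⟦ sign i ◃ 1 ⟧ * ι ℤ.∣ i ∣) * (⟦ sign j ◃ 1 ⟧ * ι ℤ.∣ j ∣)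
      ≈⟨ *-cong (⟦⟧-◃-sign i) (⟦⟧-◃-sign j) ⟨
    ⟦ i ⟧ * ⟦ j ⟧ ∎
    where
    open import Algebra.Properties.CommutativeSemigroup *-commutativeSemigroup
      using (interchange)

  cancel-1 : ∀ x y → (1# + x) - (1# + y) ≈ x - y
  cancel-1 x y = begin
    (1# + x) - (1# + y)     ≈⟨ +-congˡ (sym (⁻¹-∙-comm 1# y)) ⟩
    (1# + x) + (- 1# - y)   ≈⟨ interchange 1# x (- 1#) (- y) ⟩
    (1# - 1#) + (x - y)     ≈⟨ +-congʳ (-‿inverseʳ 1#) ⟩
    0# + (x - y)            ≈⟨ +-identityˡ _ ⟩
    x - y ∎
    where
    open import Algebra.Properties.CommutativeSemigroup +-commutativeSemigroup
      using (interchange)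

  ⟦⟧-⊖ : ∀ m n → ⟦ m ⊖ n ⟧ ≈ ι m - ι n
  ⟦⟧-⊖ m zero = sym (trans (+-congˡ -0#≈0#) (+-identityʳ _))
  ⟦⟧-⊖ zero (suc n) = sym (+-identityˡ _)
  ⟦⟧-⊖ (suc m) (suc n) = begin
    ⟦ suc m ⊖ suc n ⟧        ≡⟨ ≡.cong ⟦_⟧ (ℤ.[1+m]⊖[1+n]≡m⊖n m n) ⟩
    ⟦ m ⊖ n ⟧                ≈⟨ ⟦⟧-⊖ m n ⟩
    ι m - ι n                ≈⟨ cancel-1 _ _ ⟨
    (1# + ι m) - (1# + ι n)  ≈⟨ +-cong (1+× m 1#) (-‿cong (1+× n 1#)) ⟨
    ι (suc m) - ι (suc n)    ∎

  ⟦⟧-+-homo : ∀ i j → ⟦ i ℤ.+ j ⟧ ≈ ⟦ i ⟧ + ⟦ j ⟧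
  ⟦⟧-+-homo (ℤ.+ m)  (ℤ.+ n)  = ×-homo-+ 1# m n
  ⟦⟧-+-homo (ℤ.+ m)  -[1+ n ] = ⟦⟧-⊖ m (suc n)
  ⟦⟧-+-homo -[1+ m ] (ℤ.+ n)  = trans (⟦⟧-⊖ n (suc m)) (+-comm _ _)
  ⟦⟧-+-homo -[1+ m ] -[1+ n ] = begin
    - ι (suc (suc (m ℕ.+ n)))    ≡⟨ ≡.cong (λ k → - ι (suc k)) (≡.sym (ℕ.+-suc m n)) ⟩
    - ι (suc m ℕ.+ suc n)        ≈⟨ -‿cong (×-homo-+ 1# (suc m) (suc n)) ⟩
    - (ι (suc m) + ι (suc n))    ≈⟨ ⁻¹-∙-comm _ _ ⟨
    - ι (suc m) - ι (suc n)      ∎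

  ⟦⟧--homo : ∀ i → ⟦ ℤ.- i ⟧ ≈ - ⟦ i ⟧
  ⟦⟧--homo (ℤ.+ zero)  = sym -0#≈0#
  ⟦⟧--homo (ℤ.+ suc n) = refl
  ⟦⟧--homo -[1+ n ]    = sym (-‿involutive _)

  morphism : ℤ.+-*-rawRing -Raw-AlmostCommutative⟶ fromCommutativeRing R
  morphism = record
    { ⟦_⟧    = ⟦_⟧
    ; +-homo = ⟦⟧-+-homo
    ; *-homo = ⟦⟧-*-homo
    ; -‿homo = ⟦⟧--homo
    ; 0-homo = refl
    ; 1-homo = refl
    }

  _coeff≟_ : ∀ i j → Maybe (⟦ i ⟧ ≈ ⟦ j ⟧)
  i coeff≟ j with i ℤ.≟ j
  ... | yes ≡.refl = just refl
  ... | no _       = nothing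

  open import Algebra.Solver.Ring ℤ.+-*-rawRing (fromCommutativeRing R) morphism _coeff≟_
    public using (Polynomial; solve; _:=_; _:+_; _:*_; _:-_; :-_; con)

  infix 9 #_
  #_ : ∀ {n} → ℕ → Polynomial n
  # k = con (ℤ.+ k)

-- Ordered rings with a stable order.

-- NonNeg is the positive cone.  Totality is required only in a form that is valid for the
-- constructive reals.
record OrderedRing : Set₁ where
  field
    commutativeRing : CommutativeRing 0ℓ 0ℓ
  open CommutativeRing commutativeRing public hiding (zero)
  field
    NonNeg         : Carrier → Set
    NonNeg-resp-≈  : ∀ {x y} → x ≈ y → NonNeg x → NonNeg y
    NonNeg-+       : ∀ {x y} → NonNeg x → NonNeg y → NonNeg (x + y)
    NonNeg-*       : ∀ {x y} → NonNeg x → NonNeg y → NonNeg (x * y)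
    NonNeg-stable  : ∀ {x} → ¬ ¬ NonNeg x → NonNeg x
    NonNeg-total   : ∀ {x} → ¬ NonNeg x → NonNeg (- x)
    NonNeg-antisym : ∀ {x} → NonNeg x → NonNeg (- x) → x ≈ 0#
    NonNeg-cancel  : ∀ {x c} → ¬ NonNeg (- c) → NonNeg (x * c) → NonNeg x
    1-positive     : ¬ NonNeg (- 1#)

module OrderedRingProperties (R : OrderedRing) where
  open OrderedRing R
  open IntegerSolver commutativeRing public
    using (ι; solve; _:=_; _:+_; _:*_; _:-_; :-_; #_)
  open import Algebra.Properties.Semiring.Mult.TCOptimised semiring using (1+×; ×-homo-+)

  infix 4 _≤_
  -- A record and not a synonym, so that both sides can be read off from the type.
  record _≤_ (x y : Carrier) : Set where
    constructor mk≤
    field gap : NonNeg (y - x)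
  open _≤_ public

  Positive : Carrier → Set
  Positive x = ¬ NonNeg (- x)

  ≤-by : ∀ {x y} p → NonNeg p → y - x ≈ p → x ≤ y
  ≤-by p nn e = mk≤ (NonNeg-resp-≈ (sym e) nn)

  ≤-stable : ∀ {x y} → ¬ ¬ (x ≤ y) → x ≤ y
  ≤-stable f = mk≤ (NonNeg-stable λ n → f λ p → n (gap p))

  NonNeg⇒0≤ : ∀ {x} → NonNeg x → 0# ≤ x
  NonNeg⇒0≤ {x} nn = ≤-by x nn (solve 1 (λ x → x :- # 0 := x) refl x)

  0≤⇒NonNeg : ∀ {x} → 0# ≤ x → NonNeg x
  0≤⇒NonNeg {x} p = NonNeg-resp-≈ (solve 1 (λ x → x :- # 0 := x) refl x) (gap p)

  ≤-total : ∀ {x y} → ¬ (x ≤ y) → y ≤ x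
  ≤-total {x} {y} n = ≤-by (- (y - x)) (NonNeg-total λ p → n (mk≤ p))
    (solve 2 (λ x y → x :- y := :- (y :- x)) refl x y)

  -- Totality is available only under double negation, which does no harm when the goal is itself a
  -- stable inequality.
  ≤-cases : ∀ {x y a b} → (x ≤ y → a ≤ b) → (y ≤ x → a ≤ b) → a ≤ b
  ≤-cases f g = ≤-stable λ n → n (g (≤-total λ p → n (f p)))

  -- If it failed, `NonNeg-total` would give `NonNeg (- 0#)`, which is the same.
  NonNeg-0 : NonNeg 0#
  NonNeg-0 = NonNeg-stable λ n →
    n (NonNeg-resp-≈ (solve 0 (:- # 0 := # 0) refl) (NonNeg-total n))

  ≤-reflexive : ∀ {x y} → x ≈ y → x ≤ y
  ≤-reflexive {x} {y} e =
    ≤-by 0# NonNeg-0 (trans (+-congˡ (-‿cong e)) (-‿inverseʳ y))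

  ≤-refl : ∀ {x} → x ≤ x
  ≤-refl = ≤-reflexive refl

  NonNeg-1 : NonNeg 1#
  NonNeg-1 = NonNeg-resp-≈ (solve 0 (:- (:- # 1) := # 1) refl) (NonNeg-total 1-positive)

  NonNeg-ι : ∀ n → NonNeg (ι n)
  NonNeg-ι zero    = NonNeg-0
  NonNeg-ι (suc n) = NonNeg-resp-≈ (sym (1+× n 1#)) (NonNeg-+ NonNeg-1 (NonNeg-ι n))

  ι-positive : ∀ n → Positive (ι (suc n))
  ι-positive n q = 1-positive (NonNeg-resp-≈
    (trans (+-congʳ (-‿cong (1+× n 1#)))
           (solve 1 (λ x → :- (# 1 :+ x) :+ x := :- # 1) refl (ι n)))
    (NonNeg-+ q (NonNeg-ι n)))

  ≤-trans : ∀ {x y z} → x ≤ y → y ≤ z → x ≤ z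
  ≤-trans {x} {y} {z} p q = ≤-by _ (NonNeg-+ (gap p) (gap q))
    (solve 3 (λ x y z → z :- x := (y :- x) :+ (z :- y)) refl x y z)

  ≤-antisym : ∀ {x y} → x ≤ y → y ≤ x → x ≈ y
  ≤-antisym {x} {y} p q = begin
    x            ≈⟨ solve 2 (λ x y → x := y :- (y :- x)) refl x y ⟩
    y - (y - x)  ≈⟨ +-congˡ (-‿cong (NonNeg-antisym (gap p)
                      (NonNeg-resp-≈ (solve 2 (λ x y → x :- y := :- (y :- x)) refl x y) (gap q)))) ⟩
    y - 0#       ≈⟨ solve 1 (λ y → y :- # 0 := y) refl y ⟩
    y            ∎
    where open import Relation.Binary.Reasoning.Setoid setoid

  ≤-resp : ∀ {x x′ y y′} → x ≈ x′ → y ≈ y′ → x ≤ y → x′ ≤ y′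
  ≤-resp e f p = ≤-trans (≤-reflexive (sym e)) (≤-trans p (≤-reflexive f))

  *-cancelʳ-≤ : ∀ {x y} c → Positive c → x * c ≤ y * c → x ≤ y
  *-cancelʳ-≤ {x} {y} c c>0 p = mk≤ (NonNeg-cancel c>0 (NonNeg-resp-≈
    (solve 3 (λ x y c → y :* c :- x :* c := (y :- x) :* c) refl x y c) (gap p)))

  -- The factor `y + x` of `y² − x²` can be cancelled if it is positive; if it is not, then
  -- `y − x = −(y + x) + 2y` is nonnegative anyway.
  square-cancel-≤ : ∀ {x y} → NonNeg x → NonNeg y → x * x ≤ y * y → x ≤ y
  square-cancel-≤ {x} {y} x≥0 y≥0 p = ≤-stable λ n →
    let x+y>0 : Positive (y + x)
        x+y>0 q = n (≤-by (- (y + x) + (y + y)) (NonNeg-+ q (NonNeg-+ y≥0 y≥0))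
          (solve 2 (λ x y → y :- x := :- (y :+ x) :+ (y :+ y)) refl x y))
    in n (mk≤ (NonNeg-cancel x+y>0 (NonNeg-resp-≈
         (solve 2 (λ x y → y :* y :- x :* x := (y :- x) :* (y :+ x)) refl x y) (gap p))))

  ι-mono : ∀ {m n} → m ℕ.≤ n → ι m ≤ ι n
  ι-mono {m} {n} m≤n = ≤-by (ι (n ℕ.∸ m)) (NonNeg-ι (n ℕ.∸ m))
    (begin
      ι n - ι m                  ≡⟨ ≡.cong (λ k → ι k - ι m) (≡.sym (ℕ.m∸n+n≡m m≤n)) ⟩
      ι (n ℕ.∸ m ℕ.+ m) - ι m    ≈⟨ +-congʳ (×-homo-+ 1# (n ℕ.∸ m) m) ⟩
      ι (n ℕ.∸ m) + ι m - ι m    ≈⟨ solve 2 (λ a b → a :+ b :- b := a) refl _ _ ⟩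
      ι (n ℕ.∸ m)                ∎)
    where open import Relation.Binary.Reasoning.Setoid setoid

-- Finite sums in an ordered ring.

module Sums (R : OrderedRing) where
  open OrderedRing R
  open OrderedRingProperties R
  open import Algebra.Properties.Semiring.Sum semiring public
    using (sum; sum-cong-≋; ∑-distrib-+; ∑-comm; *-distribˡ-sum; *-distribʳ-sum)

  sum-lin₂ : ∀ {n} α β (f g : Fin n → Carrier) →
    sum (λ i → α * f i + β * g i) ≈ α * sum f + β * sum g
  sum-lin₂ α β f g = trans (∑-distrib-+ (λ i → α * f i) (λ i → β * g i))
    (sym (+-cong (*-distribˡ-sum α f) (*-distribˡ-sum β g)))

  sum-lin₃ : ∀ {n} α β γ (f g h : Fin n → Carrier) →
    sum (λ i → α * f i + β * g i + γ * h i) ≈ α * sum f + β * sum g + γ * sum h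
  sum-lin₃ α β γ f g h = trans (∑-distrib-+ (λ i → α * f i + β * g i) (λ i → γ * h i))
    (+-cong (sum-lin₂ α β f g) (sym (*-distribˡ-sum γ h)))

  sum-nonNeg : ∀ {n} {f : Fin n → Carrier} → (∀ i → NonNeg (f i)) → NonNeg (sum f)
  sum-nonNeg {zero}  p = NonNeg-0
  sum-nonNeg {suc n} p = NonNeg-+ (p zero) (sum-nonNeg (p ∘ suc))

  sum-≤ : ∀ {n} {f g : Fin n → Carrier} → (∀ i → f i ≤ g i) → sum f ≤ sum g
  sum-≤ {f = f} {g} p = ≤-by _ (sum-nonNeg (λ i → gap (p i))) (sym (begin
    sum (λ i → g i - f i)            ≈⟨ sum-cong-≋ (λ i → solve 2 (λ f g →
                                          g :- f := # 1 :* g :+ :- # 1 :* f) refl (f i) (g i)) ⟩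
    sum (λ i → 1# * g i + - 1# * f i) ≈⟨ sum-lin₂ 1# (- 1#) g f ⟩
    1# * sum g + - 1# * sum f        ≈⟨ solve 2 (λ f g →
                                          # 1 :* g :+ :- # 1 :* f := g :- f) refl (sum f) (sum g) ⟩
    sum g - sum f ∎))
    where open import Relation.Binary.Reasoning.Setoid setoid

  term-≤-sum : ∀ {n} {f : Fin n → Carrier} → (∀ i → NonNeg (f i)) → ∀ i → f i ≤ sum f
  term-≤-sum {f = f} p zero = ≤-by _ (sum-nonNeg (p ∘ suc))
    (solve 2 (λ x y → x :+ y :- x := y) refl (f zero) (sum (f ∘ suc)))
  term-≤-sum {f = f} p (suc i) = ≤-trans (term-≤-sum (p ∘ suc) i)
    (≤-by _ (p zero) (solve 2 (λ x y → x :+ y :- y := x) refl (f zero) (sum (f ∘ suc))))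

  indicator : ∀ {n} → Fin n → Fin n → Carrier
  indicator i j = if does (j Fin.≟ i) then 1# else 0#

  sum-indicator : ∀ {n} i (f : Fin n → Carrier) → sum (λ j → indicator i j * f j) ≈ f i
  sum-indicator {suc n} zero f = begin
    1# * f zero + sum (λ j → indicator zero (suc j) * f (suc j))
      ≈⟨ +-congˡ (sum-cong-≋ {n} λ j → zeroˡ (f (suc j))) ⟩
    1# * f zero + sum {n} (λ j → 0#)
      ≈⟨ +-congˡ (sum-replicate-zero n) ⟩
    1# * f zero + 0#
      ≈⟨ trans (+-identityʳ _) (*-identityˡ _) ⟩
    f zero ∎
    where
    open import Relation.Binary.Reasoning.Setoid setoid
    open import Algebra.Properties.Semiring.Sum semiring using (sum-replicate-zero)
  sum-indicator {suc n} (suc i) f = begin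
    0# * f zero + sum (λ j → indicator i j * f (suc j))
      ≈⟨ trans (+-congʳ (zeroˡ _)) (+-identityˡ _) ⟩
    sum (λ j → indicator i j * f (suc j))
      ≈⟨ sum-indicator i (f ∘ suc) ⟩
    f (suc i) ∎
    where open import Relation.Binary.Reasoning.Setoid setoid

-- Subinvariant vectors and the classes of vertices around a maximum.

-- a is the adjacency matrix of a graph in which adjacent vertices have at most r common neighbours,
-- and y stands for the absolute value of an eigenvector, of which only ρ y ≤ a y survives.
record SubinvariantVector (R : OrderedRing) (n : ℕ) : Set where
  open OrderedRing R
  open OrderedRingProperties R
  open Sums R
  field
    a       : Fin n → Fin n → Carrier
    a-sym   : ∀ i j → a i j ≡ a j i
    a-01    : ∀ i j → a i j ≡ 0# ⊎ a i j ≡ 1#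
    a-irr   : ∀ i → a i i ≡ 0#
    r       : Carrier
    r≥1     : NonNeg (r - 1#)
    codegree : ∀ v w → a v w ≡ 1# → sum (λ j → a v j * a w j) ≤ r
    ρ       : Carrier
    ρ≥9r    : NonNeg (ρ - ι 9 * r)
    ∗       : Fin n
    y       : Fin n → Carrier
    y≥0     : ∀ i → NonNeg (y i)
    y≤y∗    : ∀ i → NonNeg (y ∗ - y i)
    y∗>0    : Positive (y ∗)
    subinvariant : ∀ i → NonNeg (sum (λ j → a i j * y j) - ρ * y i)

module SpectralBound (R : OrderedRing) {n : ℕ} (H : SubinvariantVector R n) where
  open OrderedRing R
  open OrderedRingProperties R
  open Sums R
  open SubinvariantVector H
  open import Relation.Binary.Reasoning.Setoid setoid

  infixl 6 _⊕_
  _⊕_ : ∀ {x y} → NonNeg x → NonNeg y → NonNeg (x + y)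
  _⊕_ = NonNeg-+
  infixl 7 _⊗_
  _⊗_ : ∀ {x y} → NonNeg x → NonNeg y → NonNeg (x * y)
  _⊗_ = NonNeg-*

  A : (Fin n → Carrier) → Fin n → Carrier
  A u i = sum (λ j → a i j * u j)

  _·_ : (Fin n → Carrier) → (Fin n → Carrier) → Fin n → Carrier
  (u · v) i = u i * v i

  M : Carrier
  M = y ∗

  -- The indicator functions of N, W and {∗}.
  h k δ : Fin n → Carrier
  h j = a ∗ j
  δ = indicator ∗
  k j = if does (j Fin.≟ ∗) then 0# else [ const 1# , const 0# ]′ (a-01 ∗ j)

  -- Indexed by the three indicator values: a pointwise claim about `δ`, `h` and `k` becomes, class
  -- by class, a polynomial claim with constants in their place.
  data Class (j : Fin n) : (d h k : Carrier) → Set where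
    centre : Class j 1# 0# 0#
    near   : Class j 0# 1# 0#
    far    : Class j 0# 0# 1#

  classify : ∀ j → Class j (δ j) (h j) (k j)
  classify j with j Fin.≟ ∗
  ... | yes j≡∗ = ≡.subst (λ x → Class j 1# x 0#)
                    (≡.sym (≡.trans (≡.cong (a ∗) j≡∗) (a-irr ∗))) centre
  ... | no _ with a-01 ∗ j
  ...   | inj₁ e = ≡.subst (λ x → Class j 0# x 1#) (≡.sym e) far
  ...   | inj₂ e = ≡.subst (λ x → Class j 0# x 0#) (≡.sym e) near

  01-nonNeg : ∀ {x} → x ≡ 0# ⊎ x ≡ 1# → NonNeg x
  01-nonNeg (inj₁ ≡.refl) = NonNeg-0
  01-nonNeg (inj₂ ≡.refl) = NonNeg-1

  a≥0 : ∀ i j → NonNeg (a i j)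
  a≥0 i j = 01-nonNeg (a-01 i j)

  h≥0 : ∀ j → NonNeg (h j)
  h≥0 = a≥0 ∗

  k≥0 : ∀ j → NonNeg (k j)
  k≥0 j = go (classify j)
    where
    go : ∀ {d h k} → Class j d h k → NonNeg k
    go centre = NonNeg-0
    go near       = NonNeg-0
    go far        = NonNeg-1

  r≥0 : NonNeg r
  r≥0 = NonNeg-resp-≈ (solve 1 (λ r → r :- # 1 :+ # 1 := r) refl r) (r≥1 ⊕ NonNeg-1)

  ρ≥0 : NonNeg ρ
  ρ≥0 = NonNeg-resp-≈ (solve 2 (λ ρ r → ρ :- # 9 :* r :+ # 9 :* r := ρ) refl ρ r)
          (ρ≥9r ⊕ NonNeg-ι 9 ⊗ r≥0)

  A-symmetric : ∀ u v → sum (u · A v) ≈ sum (v · A u)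
  A-symmetric u v = begin
    sum (λ i → u i * sum (λ j → a i j * v j))
      ≈⟨ sum-cong-≋ (λ i → *-distribˡ-sum (u i) (λ j → a i j * v j)) ⟩
    sum (λ i → sum (λ j → u i * (a i j * v j)))
      ≈⟨ ∑-comm (λ i j → u i * (a i j * v j)) ⟩
    sum (λ j → sum (λ i → u i * (a i j * v j)))
      ≈⟨ sum-cong-≋ (λ j → sum-cong-≋ (λ i → trans
           (solve 3 (λ u a v → u :* (a :* v) := v :* (a :* u)) refl (u i) (a i j) (v j))
           (reflexive (≡.cong (λ x → v j * (x * u i)) (a-sym i j))))) ⟩
    sum (λ j → sum (λ i → v j * (a j i * u i)))
      ≈⟨ sum-cong-≋ (λ j → *-distribˡ-sum (v j) (λ i → a j i * u i)) ⟨
    sum (λ j → v j * sum (λ i → a j i * u i)) ∎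

  split : ∀ f → sum f ≈ sum (h · f) + sum (k · f) + f ∗
  split f = begin
    sum f
      ≈⟨ sum-cong-≋ (λ j → pointwise j (classify j)) ⟩
    sum (λ j → 1# * (h j * f j) + 1# * (k j * f j) + 1# * (δ j * f j))
      ≈⟨ sum-lin₃ 1# 1# 1# (h · f) (k · f) (δ · f) ⟩
    1# * sum (h · f) + 1# * sum (k · f) + 1# * sum (δ · f)
      ≈⟨ +-cong (+-cong (*-identityˡ _) (*-identityˡ _)) (trans (*-identityˡ _) (sum-indicator ∗ f)) ⟩
    sum (h · f) + sum (k · f) + f ∗ ∎
    where
    pointwise : ∀ j {d h k} → Class j d h k →
      f j ≈ 1# * (h * f j) + 1# * (k * f j) + 1# * (d * f j)
    pointwise j centre = solve 1 (λ f →
      f := # 1 :* (# 0 :* f) :+ # 1 :* (# 0 :* f) :+ # 1 :* (# 1 :* f)) refl (f j)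
    pointwise j near = solve 1 (λ f →
      f := # 1 :* (# 1 :* f) :+ # 1 :* (# 0 :* f) :+ # 1 :* (# 0 :* f)) refl (f j)
    pointwise j far = solve 1 (λ f →
      f := # 1 :* (# 0 :* f) :+ # 1 :* (# 1 :* f) :+ # 1 :* (# 0 :* f)) refl (f j)

  -- dN and dW count neighbours in N and W, t and s add up their weights, and Q v is the weight of
  -- the vertices of W that are not adjacent to v.
  dN dW t s Q : Fin n → Carrier
  dN = A h
  dW = A k
  t  = A (h · y)
  s  = A (k · y)

  d P X E : Carrier
  d = sum h
  P = sum (h · y)
  X = sum (k · y)
  E = P - ρ * M
  Q v = X - s v

  A-split : ∀ f i → A f i ≈ A (h · f) i + A (k · f) i + h i * f ∗
  A-split f i = begin
    sum (λ j → a i j * f j)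
      ≈⟨ split (λ j → a i j * f j) ⟩
    sum (λ j → h j * (a i j * f j)) + sum (λ j → k j * (a i j * f j)) + a i ∗ * f ∗
      ≈⟨ +-cong (+-cong (sum-cong-≋ λ j → rearrange (h j) (a i j) (f j))
                        (sum-cong-≋ λ j → rearrange (k j) (a i j) (f j)))
                (reflexive (≡.cong (_* f ∗) (a-sym i ∗))) ⟩
    A (h · f) i + A (k · f) i + h i * f ∗ ∎
    where
    rearrange : ∀ x y z → x * (y * z) ≈ y * (x * z)
    rearrange = solve 3 (λ x y z → x :* (y :* z) := y :* (x :* z)) refl

  row : ∀ i → sum (a i) ≈ dN i + dW i + h i
  row i = begin
    sum (a i)
      ≈⟨ sum-cong-≋ (λ j → *-identityʳ (a i j)) ⟨
    A (const 1#) i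
      ≈⟨ A-split (const 1#) i ⟩
    A (h · const 1#) i + A (k · const 1#) i + h i * 1#
      ≈⟨ +-cong (+-cong (sum-cong-≋ λ j → *-congˡ (*-identityʳ (h j)))
                        (sum-cong-≋ λ j → *-congˡ (*-identityʳ (k j)))) (*-identityʳ (h i)) ⟩
    dN i + dW i + h i ∎

  -- Edges against walks of length two from the centre.

  -- HH = 2 e(N), KH = e(N , W), KK = 2 e(W)
  HH KH KK Hd Kd : Carrier
  HH = sum (h · dN)
  KH = sum (k · dN)
  KK = sum (k · dW)
  Hd = sum (h · (y · dN))
  Kd = sum (k · (y · dN))

  hh≈h : ∀ j → h j * h j ≈ h j
  hh≈h j = go (classify j)
    where
    go : ∀ {d h k} → Class j d h k → h * h ≈ h
    go centre = zeroˡ 0#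
    go near       = *-identityˡ 1#
    go far        = zeroˡ 0#

  kh≈0 : ∀ j → k j * h j ≈ 0#
  kh≈0 j = go (classify j)
    where
    go : ∀ {d h k} → Class j d h k → k * h ≈ 0#
    go centre = zeroˡ 0#
    go near       = zeroˡ 1#
    go far        = zeroʳ 1#

  dN∗ : dN ∗ ≈ d
  dN∗ = sum-cong-≋ hh≈h

  -- The degree sum, hence twice the number of edges.
  e₂ : Carrier
  e₂ = sum (λ i → sum (a i))

  degreeSum-split : e₂ ≈ ι 2 * d + HH + ι 2 * KH + KK
  degreeSum-split = begin
    e₂ ≈⟨ split (λ i → sum (a i)) ⟩
    sum (λ i → h i * sum (a i)) + sum (λ i → k i * sum (a i)) + d
      ≈⟨ +-congʳ (+-cong (weighted h) (weighted k)) ⟩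
    (HH + sum (h · dW) + sum (h · h)) + (KH + KK + sum (k · h)) + d
      ≈⟨ +-congʳ (+-cong (+-cong (+-congˡ (A-symmetric h k)) (sum-cong-≋ hh≈h))
           (+-congˡ (trans (sum-cong-≋ kh≈0) (sum-replicate-zero n)))) ⟩
    (HH + KH + d) + (KH + KK + 0#) + d
      ≈⟨ solve 4 (λ HH KH KK d → (HH :+ KH :+ d) :+ (KH :+ KK :+ # 0) :+ d
           := # 2 :* d :+ HH :+ # 2 :* KH :+ KK) refl HH KH KK d ⟩
    ι 2 * d + HH + ι 2 * KH + KK ∎
    where
    open import Algebra.Properties.Semiring.Sum semiring using (sum-replicate-zero)
    weighted : ∀ u → sum (λ i → u i * sum (a i)) ≈ sum (u · dN) + sum (u · dW) + sum (u · h)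
    weighted u = begin
      sum (λ i → u i * sum (a i))
        ≈⟨ sum-cong-≋ (λ i → trans (*-congˡ (row i)) (solve 4 (λ u x y z →
             u :* (x :+ y :+ z) := # 1 :* (u :* x) :+ # 1 :* (u :* y) :+ # 1 :* (u :* z))
             refl (u i) (dN i) (dW i) (h i))) ⟩
      _ ≈⟨ sum-lin₃ 1# 1# 1# (u · dN) (u · dW) (u · h) ⟩
      _ ≈⟨ +-cong (+-cong (*-identityˡ _) (*-identityˡ _)) (*-identityˡ _) ⟩
      sum (u · dN) + sum (u · dW) + sum (u · h) ∎

  HAy : Carrier
  HAy = sum (h · A y)

  -- `HAy` adds the weights of the ends of all walks of length two from `∗`. Sorting them by the
  -- class of the end leaves `d` walks that return to `∗`.
  HAy-split : HAy ≈ Hd + Kd + M * d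
  HAy-split = begin
    sum (h · A y)      ≈⟨ A-symmetric h y ⟩
    sum (y · dN)       ≈⟨ split (y · dN) ⟩
    Hd + Kd + M * dN ∗ ≈⟨ +-congˡ (*-congˡ dN∗) ⟩
    Hd + Kd + M * d    ∎

  slack : Carrier
  slack = HAy - ρ * P

  slack-terms : sum (λ i → h i * (A y i - ρ * y i)) ≈ slack
  slack-terms = begin
    sum (λ i → h i * (A y i - ρ * y i))
      ≈⟨ sum-cong-≋ (λ i → solve 4 (λ h x ρ y → h :* (x :- ρ :* y)
           := # 1 :* (h :* x) :+ :- ρ :* (h :* y)) refl (h i) (A y i) ρ (y i)) ⟩
    sum (λ i → 1# * (h i * A y i) + - ρ * (h i * y i))
      ≈⟨ sum-lin₂ 1# (- ρ) (h · A y) (h · y) ⟩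
    1# * HAy + - ρ * P
      ≈⟨ solve 3 (λ x ρ p → # 1 :* x :+ :- ρ :* p := x :- ρ :* p) refl HAy ρ P ⟩
    slack ∎

  slack≥0 : NonNeg slack
  slack≥0 = NonNeg-resp-≈ slack-terms (sum-nonNeg λ i → h≥0 i ⊗ subinvariant i)

  E≥0 : NonNeg E
  -- `h` is the row of `∗`, so `P` is `A y ∗` by definition.
  E≥0 = subinvariant ∗

  -- The share of `w ∈ W` in the deficit. An edge inside `W` ends no walk of length two from `∗` and
  -- loses `2M`, half of it charged to either end; an edge from `N` to `w` ends one walk, of weight
  -- `y w` instead of `M`.
  pay : Fin n → Carrier
  pay w = M * dW w + ι 2 * (dN w * (M - y w))

  KP T₂ S₂ : Carrier
  KP = sum (k · pay)
  T₂ = ι 2 * (ρ * E) + KP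
  S₂ = ι 2 * Hd - HH * M

  KP-split : KP ≈ M * KK + ι 2 * M * KH - ι 2 * Kd
  KP-split = begin
    KP
      ≈⟨ sum-cong-≋ (λ w → solve 5 (λ k M dW dN y →
           k :* (M :* dW :+ # 2 :* (dN :* (M :- y)))
           := M :* (k :* dW) :+ (# 2 :* M) :* (k :* dN) :+ :- # 2 :* (k :* (y :* dN)))
           refl (k w) M (dW w) (dN w) (y w)) ⟩
    _ ≈⟨ sum-lin₃ M (ι 2 * M) (- ι 2) (k · dW) (k · dN) (k · (y · dN)) ⟩
    M * KK + ι 2 * M * KH + - ι 2 * Kd
      ≈⟨ solve 4 (λ M KK KH Kd → M :* KK :+ # 2 :* M :* KH :+ :- # 2 :* Kd
           := M :* KK :+ # 2 :* M :* KH :- # 2 :* Kd) refl M KK KH Kd ⟩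
    M * KK + ι 2 * M * KH - ι 2 * Kd ∎

  -- Each edge has `2M` on the left and twice the weight of the walks from `∗` having it as second
  -- step on the right. Edges at `∗` cancel exactly, an edge `uv` inside `N` ends two walks and
  -- overshoots by `2 (y u + y v − M)`, and the others lose what `pay` records. The total `HAy` of
  -- the walks is `slack + ρ P`, with `P = ρ M + E`.
  balance : e₂ * M ≈ ι 2 * slack + ι 2 * (ρ * ρ * M) + T₂ - S₂
  balance = begin
    e₂ * M
      ≈⟨ *-congʳ degreeSum-split ⟩
    (ι 2 * d + HH + ι 2 * KH + KK) * M
      ≈⟨ solve 9 (λ d HH KH KK M Hd Kd ρ P →
           (# 2 :* d :+ HH :+ # 2 :* KH :+ KK) :* M
           := # 2 :* (Hd :+ Kd :+ M :* d :- ρ :* P) :+ # 2 :* (ρ :* ρ :* M)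
              :+ (# 2 :* (ρ :* (P :- ρ :* M)) :+ (M :* KK :+ # 2 :* M :* KH :- # 2 :* Kd))
              :- (# 2 :* Hd :- HH :* M)) refl d HH KH KK M Hd Kd ρ P ⟩
    ι 2 * (Hd + Kd + M * d - ρ * P) + ι 2 * (ρ * ρ * M)
      + (ι 2 * (ρ * E) + (M * KK + ι 2 * M * KH - ι 2 * Kd)) - S₂
      ≈⟨ +-congʳ (+-cong (+-congʳ (*-congˡ (+-congʳ HAy-split))) (+-congˡ KP-split)) ⟨
    ι 2 * slack + ι 2 * (ρ * ρ * M) + T₂ - S₂ ∎

  -- Deficits against the weight of the nonadjacent pairs.

  M≥0 : NonNeg M
  M≥0 = y≥0 ∗

  A-nonNeg : ∀ {u} → (∀ j → NonNeg (u j)) → ∀ i → NonNeg (A u i)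
  A-nonNeg u≥0 i = sum-nonNeg λ j → a≥0 i j ⊗ u≥0 j

  sum-diff : ∀ {n} (f g : Fin n → Carrier) → sum (λ i → f i - g i) ≈ sum f - sum g
  sum-diff f g = begin
    sum (λ i → f i - g i)
      ≈⟨ sum-cong-≋ (λ i → solve 2 (λ f g → f :- g := # 1 :* f :+ :- # 1 :* g) refl (f i) (g i)) ⟩
    _ ≈⟨ sum-lin₂ 1# (- 1#) f g ⟩
    _ ≈⟨ solve 2 (λ f g → # 1 :* f :+ :- # 1 :* g := f :- g) refl (sum f) (sum g) ⟩
    sum f - sum g ∎

  A-scaled : ∀ {u} → (∀ j → NonNeg (u j)) → ∀ i → NonNeg (M * A u i - A (u · y) i)
  A-scaled {u} u≥0 i = NonNeg-resp-≈
    (begin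
      sum (λ j → a i j * (u j * (M - y j)))
        ≈⟨ sum-cong-≋ (λ j → solve 4 (λ a u M y →
             a :* (u :* (M :- y)) := M :* (a :* u) :- a :* (u :* y)) refl (a i j) (u j) M (y j)) ⟩
      _ ≈⟨ sum-diff {n} _ _ ⟩
      _ ≈⟨ +-congʳ (*-distribˡ-sum M (λ j → a i j * u j)) ⟨
      M * A u i - A (u · y) i ∎)
    (sum-nonNeg λ j → a≥0 i j ⊗ (u≥0 j ⊗ y≤y∗ j))

  hy≥0 : ∀ j → NonNeg (h j * y j)
  hy≥0 j = h≥0 j ⊗ y≥0 j

  ky≥0 : ∀ j → NonNeg (k j * y j)
  ky≥0 j = k≥0 j ⊗ y≥0 j

  X≥0 : NonNeg X
  X≥0 = sum-nonNeg ky≥0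

  pay≥0 : ∀ w → NonNeg (pay w)
  pay≥0 w = M≥0 ⊗ A-nonNeg k≥0 w ⊕ NonNeg-ι 2 ⊗ (A-nonNeg h≥0 w ⊗ y≤y∗ w)

  KP≥0 : NonNeg KP
  KP≥0 = sum-nonNeg λ w → k≥0 w ⊗ pay≥0 w

  -- Z is the sum of y v y w over the nonadjacent pairs v ∈ N, w ∈ W.
  Y Z D : Carrier
  Y = sum (k · (y · t))
  Z = P * X - Y
  D = X + ι 2 * ρ * M

  -- Pointwise on `W`: as `M dW ≥ s` and `M dN ≥ t`, `M * pay w` is at least `M s + 2 t (M − y w) =
  -- M (s + t) + t (M − y w) − t y w`. There `s + t = A y w ≥ ρ y
  -- w`, and the middle term is dropped. Since `P = ρ M + E`, the quantity bounded from below is `Z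
  -- − X E`.
  pay-bound : NonNeg (M * KP - (ρ * M * X - Y))
  pay-bound = NonNeg-resp-≈
    (begin
      _ ≈⟨ sum-cong-≋ (λ w → begin
             k w * (M * (M * dW w - s w) + ι 2 * ((M * dN w - t w) * (M - y w))
               + M * (A y w - ρ * y w) + t w * (M - y w))
               ≈⟨ *-congˡ (+-congʳ (+-congˡ (*-congˡ (+-congʳ (A-split y w))))) ⟩
             k w * (M * (M * dW w - s w) + ι 2 * ((M * dN w - t w) * (M - y w))
               + M * (t w + s w + h w * M - ρ * y w) + t w * (M - y w))
               ≈⟨ solve 9 (λ k h M dW dN s t y ρ →
                    k :* (M :* (M :* dW :- s) :+ # 2 :* ((M :* dN :- t) :* (M :- y))
                      :+ M :* (t :+ s :+ h :* M :- ρ :* y) :+ t :* (M :- y))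
                    := M :* M :* (k :* h) :+ (M :* (k :* (M :* dW :+ # 2 :* (dN :* (M :- y))))
                       :+ :- (ρ :* M) :* (k :* y) :+ # 1 :* (k :* (y :* t))))
                    refl (k w) (h w) M (dW w) (dN w) (s w) (t w) (y w) ρ ⟩
             M * M * (k w * h w) + (M * (k w * pay w) + - (ρ * M) * (k w * y w)
               + 1# * (k w * (y w * t w)))
               ≈⟨ trans (+-congʳ (trans (*-congˡ (kh≈0 w)) (zeroʳ _))) (+-identityˡ _) ⟩
             M * (k w * pay w) + - (ρ * M) * (k w * y w) + 1# * (k w * (y w * t w)) ∎) ⟩
      _ ≈⟨ sum-lin₃ M (- (ρ * M)) 1# (k · pay) (k · y) (k · (y · t)) ⟩
      _ ≈⟨ solve 5 (λ M KP ρ X Y → M :* KP :+ :- (ρ :* M) :* X :+ # 1 :* Y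
             := M :* KP :- (ρ :* M :* X :- Y)) refl M KP ρ X Y ⟩
      M * KP - (ρ * M * X - Y) ∎)
    (sum-nonNeg λ w → k≥0 w ⊗ (M≥0 ⊗ A-scaled k≥0 w
      ⊕ NonNeg-ι 2 ⊗ (A-scaled h≥0 w ⊗ y≤y∗ w)
      ⊕ M≥0 ⊗ subinvariant w
      ⊕ A-nonNeg hy≥0 w ⊗ y≤y∗ w))

  -- Expanding `D * T₂` yields the cross terms `2ρ (X E + M KP)`, which by `pay-bound` are at least
  -- `2ρ Z`; the remaining products are nonnegative.
  T-bound : NonNeg (D * T₂ - ι 2 * (ρ * Z))
  T-bound = NonNeg-resp-≈
    (solve 6 (λ ρ M P X Y KP →
      # 4 :* (ρ :* ρ :* M :* (P :- ρ :* M)) :+ X :* KP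
        :+ # 2 :* (ρ :* (M :* KP :- (ρ :* M :* X :- Y)))
      := (X :+ # 2 :* ρ :* M) :* (# 2 :* (ρ :* (P :- ρ :* M)) :+ KP)
         :- # 2 :* (ρ :* (P :* X :- Y))) refl ρ M P X Y KP)
    (NonNeg-ι 4 ⊗ (ρ≥0 ⊗ ρ≥0 ⊗ M≥0 ⊗ E≥0) ⊕ X≥0 ⊗ KP≥0 ⊕ NonNeg-ι 2 ⊗ (ρ≥0 ⊗ pay-bound))

  -- The same pairs, collected at their ends in `N`, where the edges with surplus live.
  Z-split : sum (h · (y · Q)) ≈ Z
  Z-split = begin
    sum (h · (y · Q))
      ≈⟨ sum-cong-≋ (λ v → solve 4 (λ h y X s → h :* (y :* (X :- s))
           := X :* (h :* y) :+ :- # 1 :* (h :* y :* s)) refl (h v) (y v) X (s v)) ⟩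
    _ ≈⟨ sum-lin₂ X (- 1#) (h · y) ((h · y) · s) ⟩
    X * P + - 1# * sum ((h · y) · A (k · y))
      ≈⟨ +-congˡ (*-congˡ (trans (A-symmetric (h · y) (k · y))
           (sum-cong-≋ λ w → *-assoc (k w) (y w) (t w)))) ⟩
    X * P + - 1# * Y
      ≈⟨ solve 3 (λ X P Y → X :* P :+ :- # 1 :* Y := P :* X :- Y) refl X P Y ⟩
    Z ∎

  -- Edges inside the neighbourhood and their surplus.

  1-a≥0 : ∀ i j → NonNeg (1# - a i j)
  1-a≥0 i j with a i j | a-01 i j
  ... | _ | inj₁ ≡.refl = NonNeg-resp-≈ (solve 0 (# 1 := # 1 :- # 0) refl) NonNeg-1
  ... | _ | inj₂ ≡.refl = NonNeg-resp-≈ (solve 0 (# 0 := # 1 :- # 1) refl) NonNeg-0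

  Q≥0 : ∀ v → NonNeg (Q v)
  Q≥0 v = gap (sum-≤ λ j → ≤-by _ (1-a≥0 v j ⊗ ky≥0 j)
    (solve 2 (λ a u → u :- a :* u := (# 1 :- a) :* u) refl (a v j) (k j * y j)))

  common : Fin n → Fin n → Carrier
  common v w = sum (λ j → a v j * a w j)

  -- a ∨ b ≤ 1 for a, b ∈ {0, 1}
  union≤1 : ∀ u v j → NonNeg (1# + a u j * a v j - a u j - a v j)
  union≤1 u v j = NonNeg-resp-≈
    (solve 2 (λ a b → (# 1 :- a) :* (# 1 :- b) := # 1 :+ a :* b :- a :- b) refl (a u j) (a v j))
    (1-a≥0 u j ⊗ 1-a≥0 v j)

  -- The neighbours of `v` inside `N` are the common neighbours of the adjacent vertices `v` and
  -- `∗`.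
  dN≤r : ∀ v → h v ≡ 1# → NonNeg (r - dN v)
  dN≤r v hv = gap (codegree v ∗ (≡.trans (a-sym v ∗) hv))

  t≤rM : ∀ v → h v ≡ 1# → NonNeg (r * M - t v)
  t≤rM v hv = NonNeg-resp-≈
    (solve 4 (λ r M dN t → M :* (r :- dN) :+ (M :* dN :- t) := r :* M :- t) refl r M (dN v) (t v))
    (M≥0 ⊗ dN≤r v hv ⊕ A-scaled h≥0 v)

  module Pair (u v : Fin n) (hu : h u ≡ 1#) (hv : h v ≡ 1#) (uv : a u v ≡ 1#) where

    common≤r : NonNeg (r - common u v)
    common≤r = gap (codegree u v uv)

    -- Every vertex of `W` is missed by `u` or by `v`, except for their at most `r` common
    -- neighbours, of weight at most `M` each.
    Q-sum : NonNeg (Q u + Q v - X + r * M)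
    Q-sum = NonNeg-resp-≈
      (begin
        sum (λ j → k j * y j * (1# + a u j * a v j - a u j - a v j)
            + (M - k j * y j) * (a u j * a v j)) + M * (r - common u v)
          ≈⟨ +-congʳ (sum-cong-≋ λ j → solve 4 (λ x M a b →
               x :* (# 1 :+ a :* b :- a :- b) :+ (M :- x) :* (a :* b)
               := # 1 :* x :+ :- # 1 :* (a :* x :+ b :* x) :+ M :* (a :* b))
               refl (k j * y j) M (a u j) (a v j)) ⟩
        _ ≈⟨ +-congʳ (sum-lin₃ 1# (- 1#) M (k · y)
               (λ j → a u j * (k j * y j) + a v j * (k j * y j)) (λ j → a u j * a v j)) ⟩
        _ ≈⟨ +-congʳ (+-congʳ (+-congˡ (*-congˡ (∑-distrib-+ {n} _ _)))) ⟩
        1# * X + - 1# * (s u + s v) + M * common u v + M * (r - common u v)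
          ≈⟨ solve 6 (λ X su sv M c r → # 1 :* X :+ :- # 1 :* (su :+ sv) :+ M :* c :+ M :* (r :- c)
               := X :- su :+ (X :- sv) :- X :+ r :* M) refl X (s u) (s v) M (common u v) r ⟩
        Q u + Q v - X + r * M ∎)
      (sum-nonNeg (λ j → ky≥0 j ⊗ union≤1 u v j
         ⊕ ky≤M j (classify j) ⊗ (a≥0 u j ⊗ a≥0 v j)) ⊕ M≥0 ⊗ common≤r)
      where
      ky≤M : ∀ j {d h k} → Class j d h k → NonNeg (M - k * y j)
      ky≤M j centre = NonNeg-resp-≈ (solve 2 (λ M y → M := M :- # 0 :* y) refl M (y j)) M≥0
      ky≤M j near = NonNeg-resp-≈ (solve 2 (λ M y → M := M :- # 0 :* y) refl M (y j)) M≥0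
      ky≤M j far = NonNeg-resp-≈ (solve 2 (λ M y → M :- y := M :- # 1 :* y) refl M (y j)) (y≤y∗ j)

    -- Count the neighbours of `u` and `v` together: `W` once gives `X`, `∗` once gives `M`, the
    -- parts inside `N` give at most `2rM`, and counting common neighbours a second time costs at
    -- most `rM`.
    neighbours : NonNeg (X + (ι 3 * r + 1#) * M - A y u - A y v)
    neighbours = NonNeg-resp-≈
      (begin
        sum (λ j → excess j) + (M * (r - common u v) + (r * M - t u) + (r * M - t v))
          ≈⟨ +-congʳ total ⟩
        X + M + (t u + t v) + M * common u v - (A y u + A y v)
          + (M * (r - common u v) + (r * M - t u) + (r * M - t v))
          ≈⟨ solve 8 (λ X M tu tv c Au Av r →
               X :+ M :+ (tu :+ tv) :+ M :* c :- (Au :+ Av)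
                 :+ (M :* (r :- c) :+ (r :* M :- tu) :+ (r :* M :- tv))
               := X :+ (# 3 :* r :+ # 1) :* M :- Au :- Av)
               refl X M (t u) (t v) (common u v) (A y u) (A y v) r ⟩
        X + (ι 3 * r + 1#) * M - A y u - A y v ∎)
      (sum-nonNeg (λ j → pointwise j (classify j))
        ⊕ (M≥0 ⊗ common≤r ⊕ t≤rM u hu ⊕ t≤rM v hv))
      where
      excess : Fin n → Carrier
      excess j = (k j * y j + δ j * M + (a u j * (h j * y j) + a v j * (h j * y j)))
                 + M * (a u j * a v j) - (a u j * y j + a v j * y j)

      total : sum excess ≈ X + M + (t u + t v) + M * common u v - (A y u + A y v)
      total = begin
        sum excess
          ≈⟨ sum-diff {n} _ _ ⟩
        _ ≈⟨ +-cong (trans (∑-distrib-+ {n} _ _)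
               (+-cong (trans (∑-distrib-+ {n} _ _)
                         (+-cong (trans (∑-distrib-+ {n} _ _)
                                   (+-congˡ (sum-indicator ∗ (const M))))
                                 (∑-distrib-+ {n} _ _)))
                       (sym (*-distribˡ-sum M (λ j → a u j * a v j)))))
               (-‿cong (∑-distrib-+ {n} _ _)) ⟩
        X + M + (t u + t v) + M * common u v - (A y u + A y v) ∎

      pointwise : ∀ j {d h k} → Class j d h k →
        NonNeg ((k * y j + d * M + (a u j * (h * y j) + a v j * (h * y j)))
                 + M * (a u j * a v j) - (a u j * y j + a v j * y j))
      pointwise j centre = NonNeg-resp-≈
        (solve 4 (λ M y a b →
          (M :- y) :* (a :+ b) :+ M :* (# 1 :+ a :* b :- a :- b)
          := (# 0 :* y :+ # 1 :* M :+ (a :* (# 0 :* y) :+ b :* (# 0 :* y)))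
             :+ M :* (a :* b) :- (a :* y :+ b :* y)) refl M (y j) (a u j) (a v j))
        (y≤y∗ j ⊗ (a≥0 u j ⊕ a≥0 v j) ⊕ M≥0 ⊗ union≤1 u v j)
      pointwise j near = NonNeg-resp-≈
        (solve 4 (λ M y a b →
          M :* (a :* b)
          := (# 0 :* y :+ # 0 :* M :+ (a :* (# 1 :* y) :+ b :* (# 1 :* y)))
             :+ M :* (a :* b) :- (a :* y :+ b :* y)) refl M (y j) (a u j) (a v j))
        (M≥0 ⊗ (a≥0 u j ⊗ a≥0 v j))
      pointwise j far = NonNeg-resp-≈
        (solve 4 (λ M y a b →
          (M :- y) :* (a :* b) :+ y :* (# 1 :+ a :* b :- a :- b)
          := (# 1 :* y :+ # 0 :* M :+ (a :* (# 0 :* y) :+ b :* (# 0 :* y)))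
             :+ M :* (a :* b) :- (a :* y :+ b :* y)) refl M (y j) (a u j) (a v j))
        (y≤y∗ j ⊗ (a≥0 u j ⊗ a≥0 v j) ⊕ y≥0 j ⊗ union≤1 u v j)

    surplus : Carrier
    surplus = y u + y v - M

    -- By subinvariance `ρ M ≤ ρ (y u + y v) ≤ A y u + A y v`, so `neighbours` bounds `X` from
    -- below; `r ≥ 1` turns `3r + 1` into `4r`.
    X-large : NonNeg surplus → NonNeg (X - (ρ - ι 4 * r) * M)
    X-large q = NonNeg-resp-≈
      (solve 8 (λ X r M Au Av ρ yu yv →
         (X :+ (# 3 :* r :+ # 1) :* M :- Au :- Av) :+ (Au :- ρ :* yu) :+ (Av :- ρ :* yv)
           :+ ρ :* (yu :+ yv :- M) :+ (r :- # 1) :* M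
         := X :- (ρ :- # 4 :* r) :* M) refl X r M (A y u) (A y v) ρ (y u) (y v))
      (neighbours ⊕ subinvariant u ⊕ subinvariant v ⊕ ρ≥0 ⊗ q ⊕ r≥1 ⊗ M≥0)

    -- If the surplus is nonnegative then, with ρ = 9r + e and X = (ρ − 4r) M + g,
    --   2 ρ (X − r M) − 3 r D = g (15 r + 2 e) + M (3 r² + 17 r e + 2 e²).
    bound : ι 3 * r * D * surplus ≤ ι 2 * ρ * (y u * Q u + y v * Q v)
    bound = ≤-cases {0#} {surplus}
      (λ p → let q = 0≤⇒NonNeg p in ≤-by _
        -- As `y v ≤ M` and `y u ≤ M`, the surplus is at most `y u` and at most `y v`, so
        -- `y u Q u + y v Q v` is at least `surplus * (Q u + Q v)`, and `Q-sum` applies.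
        (NonNeg-ι 2 ⊗ ρ≥0 ⊗ (y≤y∗ v ⊗ Q≥0 u ⊕ y≤y∗ u ⊗ Q≥0 v)
          ⊕ q ⊗ (NonNeg-ι 2 ⊗ ρ≥0 ⊗ Q-sum
                 ⊕ (X-large q ⊗ (NonNeg-ι 15 ⊗ r≥0 ⊕ NonNeg-ι 2 ⊗ ρ≥9r)
                    ⊕ M≥0 ⊗ (NonNeg-ι 3 ⊗ r≥0 ⊗ r≥0 ⊕ NonNeg-ι 17 ⊗ r≥0 ⊗ ρ≥9r
                              ⊕ NonNeg-ι 2 ⊗ ρ≥9r ⊗ ρ≥9r))))
        (solve 8 (λ r X ρ M yu yv Qu Qv →
          # 2 :* ρ :* (yu :* Qu :+ yv :* Qv)
            :- # 3 :* r :* (X :+ # 2 :* ρ :* M) :* (yu :+ yv :- M)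
          := # 2 :* ρ :* ((M :- yv) :* Qu :+ (M :- yu) :* Qv)
             :+ (yu :+ yv :- M) :* (# 2 :* ρ :* (Qu :+ Qv :- X :+ r :* M)
               :+ ((X :- (ρ :- # 4 :* r) :* M) :* (# 15 :* r :+ # 2 :* (ρ :- # 9 :* r))
                   :+ M :* (# 3 :* r :* r :+ # 17 :* r :* (ρ :- # 9 :* r)
                            :+ # 2 :* (ρ :- # 9 :* r) :* (ρ :- # 9 :* r)))))
          refl r X ρ M (y u) (y v) (Q u) (Q v)))
      (λ p → ≤-by _
        (NonNeg-ι 2 ⊗ ρ≥0 ⊗ (y≥0 u ⊗ Q≥0 u ⊕ y≥0 v ⊗ Q≥0 v)
          ⊕ NonNeg-ι 3 ⊗ r≥0 ⊗ (X≥0 ⊕ NonNeg-ι 2 ⊗ ρ≥0 ⊗ M≥0) ⊗ gap p)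
        (solve 8 (λ r X ρ M yu yv Qu Qv →
          # 2 :* ρ :* (yu :* Qu :+ yv :* Qv)
            :- # 3 :* r :* (X :+ # 2 :* ρ :* M) :* (yu :+ yv :- M)
          := # 2 :* ρ :* (yu :* Qu :+ yv :* Qv)
            :+ # 3 :* r :* (X :+ # 2 :* ρ :* M) :* (# 0 :- (yu :+ yv :- M)))
          refl r X ρ M (y u) (y v) (Q u) (Q v)))

  -- Summation of an edge inequality over the ordered adjacent pairs inside `N`: `g u` occurs `dN u`
  -- times as first and as often as second end, and `HH` is the number of pairs.
  pairs : ∀ (g : Fin n → Carrier) c →
    (∀ u v → h u ≡ 1# → h v ≡ 1# → a u v ≡ 1# → NonNeg (g u + g v + c)) →
    NonNeg (ι 2 * sum (h · (g · dN)) + c * HH)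
  pairs g c nn = NonNeg-resp-≈
    (begin
      sum (λ u → h u * sum (λ v → a u v * (h v * (g u + g v + c))))
        ≈⟨ sum-cong-≋ (λ u → begin
             h u * sum (λ v → a u v * (h v * (g u + g v + c)))
               ≈⟨ *-congˡ (sum-cong-≋ λ v → solve 5 (λ a h g g′ c →
                    a :* (h :* (g :+ g′ :+ c))
                    := g :* (a :* h) :+ # 1 :* (a :* (h :* g′)) :+ c :* (a :* h))
                    refl (a u v) (h v) (g u) (g v) c) ⟩
             _ ≈⟨ *-congˡ (sum-lin₃ (g u) 1# c (λ v → a u v * h v)
                    (λ v → a u v * (h v * g v)) (λ v → a u v * h v)) ⟩
             h u * (g u * dN u + 1# * A (h · g) u + c * dN u)
               ≈⟨ solve 5 (λ h g dN x c →
                    h :* (g :* dN :+ # 1 :* x :+ c :* dN)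
                    := # 1 :* (h :* (g :* dN)) :+ # 1 :* (h :* x) :+ c :* (h :* dN))
                    refl (h u) (g u) (dN u) (A (h · g) u) c ⟩
             1# * (h u * (g u * dN u)) + 1# * (h u * A (h · g) u) + c * (h u * dN u) ∎) ⟩
      _ ≈⟨ sum-lin₃ 1# 1# c (h · (g · dN)) (h · A (h · g)) (h · dN) ⟩
      1# * sum (h · (g · dN)) + 1# * sum (h · A (h · g)) + c * HH
        ≈⟨ +-congʳ (+-congˡ (*-congˡ (trans (A-symmetric h (h · g))
             (sum-cong-≋ λ u → *-assoc (h u) (g u) (dN u))))) ⟩
      1# * sum (h · (g · dN)) + 1# * sum (h · (g · dN)) + c * HH
        ≈⟨ solve 3 (λ x c HH → # 1 :* x :+ # 1 :* x :+ c :* HH := # 2 :* x :+ c :* HH)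
             refl (sum (h · (g · dN))) c HH ⟩
      ι 2 * sum (h · (g · dN)) + c * HH ∎)
    (sum-nonNeg λ u → weighted (a-01 ∗ u) λ hu → sum-nonNeg λ v →
       weighted (a-01 u v) λ uv → weighted (a-01 ∗ v) λ hv → nn u v hu hv uv)
    where
    weighted : ∀ {w x} → w ≡ 0# ⊎ w ≡ 1# → (w ≡ 1# → NonNeg x) → NonNeg (w * x)
    weighted (inj₁ ≡.refl) f = NonNeg-resp-≈ (sym (zeroˡ _)) NonNeg-0
    weighted (inj₂ ≡.refl) f = NonNeg-resp-≈ (sym (*-identityˡ _)) (f ≡.refl)

  -- Summing `Pair.bound` over the edges inside `N`, `y v * Q v` occurs with multiplicity `dN v` at
  -- either end. By `dN≤r` this is at most `r`, and adding the missing `r − dN v` completes the sum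
  -- to `r Z`.
  surplus-bound : NonNeg (ι 4 * (ρ * (r * Z)) - ι 3 * r * D * S₂)
  surplus-bound = NonNeg-resp-≈
    (begin
      ι 4 * (ρ * sum (λ v → h v * (y v * Q v) * (r - dN v)))
        + (ι 2 * sum (h · (g · dN)) + ι 3 * r * D * M * HH)
        ≈⟨ +-cong (*-congˡ (*-congˡ split-Z)) (+-congʳ (*-congˡ split-g)) ⟩
      ι 4 * (ρ * (r * Z + - 1# * W))
        + (ι 2 * (ι 2 * ρ * W + - (ι 3 * r * D) * Hd) + ι 3 * r * D * M * HH)
        ≈⟨ solve 8 (λ ρ r Z W D Hd M HH →
             # 4 :* (ρ :* (r :* Z :+ :- # 1 :* W))
               :+ (# 2 :* (# 2 :* ρ :* W :+ :- (# 3 :* r :* D) :* Hd) :+ # 3 :* r :* D :* M :* HH)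
             := # 4 :* (ρ :* (r :* Z)) :- # 3 :* r :* D :* (# 2 :* Hd :- HH :* M))
             refl ρ r Z W D Hd M HH ⟩
      ι 4 * (ρ * (r * Z)) - ι 3 * r * D * S₂ ∎)
    (NonNeg-ι 4 ⊗ (ρ≥0 ⊗ sum-nonNeg (λ v → h-weighted v (a-01 ∗ v)))
      ⊕ pairs g (ι 3 * r * D * M) (λ u v hu hv uv → NonNeg-resp-≈
          (solve 8 (λ r D ρ M yu yv Qu Qv →
             # 2 :* ρ :* (yu :* Qu :+ yv :* Qv) :- # 3 :* r :* D :* (yu :+ yv :- M)
             := # 2 :* ρ :* (yu :* Qu) :- # 3 :* r :* D :* yu
                :+ (# 2 :* ρ :* (yv :* Qv) :- # 3 :* r :* D :* yv) :+ # 3 :* r :* D :* M)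
             refl r D ρ M (y u) (y v) (Q u) (Q v))
          (gap (Pair.bound u v hu hv uv))))
    where
    g : Fin n → Carrier
    g v = ι 2 * ρ * (y v * Q v) - ι 3 * r * D * y v
    W : Carrier
    W = sum (h · ((y · Q) · dN))
    h-weighted : ∀ v → h v ≡ 0# ⊎ h v ≡ 1# → NonNeg (h v * (y v * Q v) * (r - dN v))
    h-weighted v (inj₁ e) = NonNeg-resp-≈
      (sym (trans (*-congʳ (trans (*-congʳ (reflexive e)) (zeroˡ _))) (zeroˡ _))) NonNeg-0
    h-weighted v (inj₂ e) = h≥0 v ⊗ (y≥0 v ⊗ Q≥0 v) ⊗ dN≤r v e
    split-Z : sum (λ v → h v * (y v * Q v) * (r - dN v)) ≈ r * Z + - 1# * W
    split-Z = begin
      _ ≈⟨ sum-cong-≋ (λ v → solve 5 (λ h y Q r dN → h :* (y :* Q) :* (r :- dN)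
             := r :* (h :* (y :* Q)) :+ :- # 1 :* (h :* (y :* Q :* dN)))
             refl (h v) (y v) (Q v) r (dN v)) ⟩
      _ ≈⟨ sum-lin₂ r (- 1#) (h · (y · Q)) (h · ((y · Q) · dN)) ⟩
      _ ≈⟨ +-congʳ (*-congˡ Z-split) ⟩
      r * Z + - 1# * W ∎
    split-g : sum (h · (g · dN)) ≈ ι 2 * ρ * W + - (ι 3 * r * D) * Hd
    split-g = begin
      _ ≈⟨ sum-cong-≋ (λ v → solve 7 (λ h y Q ρ r D dN →
             h :* ((# 2 :* ρ :* (y :* Q) :- # 3 :* r :* D :* y) :* dN)
             := # 2 :* ρ :* (h :* (y :* Q :* dN)) :+ :- (# 3 :* r :* D) :* (h :* (y :* dN)))
             refl (h v) (y v) (Q v) ρ r D (dN v)) ⟩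
      _ ≈⟨ sum-lin₂ (ι 2 * ρ) (- (ι 3 * r * D)) (h · ((y · Q) · dN)) (h · (y · dN)) ⟩
      ι 2 * ρ * W + - (ι 3 * r * D) * Hd ∎

  -- In fact `r D ≥ 18 M`: write `2ρ r = 18 + 36 (r − 1) + 18 (r − 1)² + 2 (ρ − 9r)
  -- r`. Keeping back one of the 18 copies of `M` contradicts `M > 0`.
  rD>0 : Positive (r * D)
  rD>0 q = y∗>0 (NonNeg-resp-≈
    (solve 4 (λ r ρ X M →
       :- (r :* (X :+ # 2 :* ρ :* M)) :+ (r :* X :+ (# 17 :* M
         :+ (# 36 :* (r :- # 1) :+ # 18 :* ((r :- # 1) :* (r :- # 1))
             :+ # 2 :* (ρ :- # 9 :* r) :* r) :* M))
       := :- M) refl r ρ X M)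
    (q ⊕ (r≥0 ⊗ X≥0 ⊕ (NonNeg-ι 17 ⊗ M≥0
       ⊕ (NonNeg-ι 36 ⊗ r≥1 ⊕ NonNeg-ι 18 ⊗ (r≥1 ⊗ r≥1) ⊕ NonNeg-ι 2 ⊗ ρ≥9r ⊗ r≥0) ⊗ M≥0))))

  -- `Z` is eliminated: `2r` times `T-bound` and `surplus-bound` meet in `4ρ r Z`.
  T-S-bound : NonNeg (ι 2 * T₂ - ι 3 * S₂)
  T-S-bound = NonNeg-cancel rD>0 (NonNeg-resp-≈
    (solve 6 (λ r D T₂ S₂ ρ Z →
       # 2 :* (r :* (D :* T₂ :- # 2 :* (ρ :* Z))) :+ (# 4 :* (ρ :* (r :* Z)) :- # 3 :* r :* D :* S₂)
       := (# 2 :* T₂ :- # 3 :* S₂) :* (r :* D)) refl r D T₂ S₂ ρ Z)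
    (NonNeg-ι 2 ⊗ (r≥0 ⊗ T-bound) ⊕ surplus-bound))

  T₂≥0 : NonNeg T₂
  T₂≥0 = NonNeg-ι 2 ⊗ (ρ≥0 ⊗ E≥0) ⊕ KP≥0

  -- After multiplication by `3M`, `balance` leaves `6 slack + 3 (T₂ − S₂)`, and `3 (T₂ − S₂)` is
  -- written as `T₂ + (2 T₂ − 3 S₂)`.
  ρ²-bound : ι 2 * (ρ * ρ) ≤ e₂
  ρ²-bound = *-cancelʳ-≤ M y∗>0 (*-cancelʳ-≤ (ι 3) (ι-positive 2) (≤-by _
    (NonNeg-ι 6 ⊗ slack≥0 ⊕ (T₂≥0 ⊕ T-S-bound))
    (begin
      e₂ * M * ι 3 - ι 2 * (ρ * ρ) * M * ι 3
        ≈⟨ +-congʳ (*-congʳ balance) ⟩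
      _ ≈⟨ solve 5 (λ σ ρ M T₂ S₂ →
             (# 2 :* σ :+ # 2 :* (ρ :* ρ :* M) :+ T₂ :- S₂) :* # 3 :- # 2 :* (ρ :* ρ) :* M :* # 3
             := # 6 :* σ :+ (T₂ :+ (# 2 :* T₂ :- # 3 :* S₂))) refl slack ρ M T₂ S₂ ⟩
      ι 6 * slack + (T₂ + (ι 2 * T₂ - ι 3 * S₂)) ∎)))

  -- The case of equality.

  module Tight (tight : e₂ ≤ ι 2 * (ρ * ρ)) where

    private
      -- The three nonnegative parts that prove `ρ²-bound` now have sum at most zero, so each of
      -- them vanishes.
      deficit : NonNeg (- (ι 6 * slack + (T₂ + (ι 2 * T₂ - ι 3 * S₂))))
      deficit = NonNeg-resp-≈
        (begin
          ι 3 * ((ι 2 * (ρ * ρ) - e₂) * M)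
            ≈⟨ solve 3 (λ ρ e M → # 3 :* ((# 2 :* (ρ :* ρ) :- e) :* M)
                 := # 3 :* (# 2 :* (ρ :* ρ) :* M :- e :* M)) refl ρ e₂ M ⟩
          ι 3 * (ι 2 * (ρ * ρ) * M - e₂ * M)
            ≈⟨ *-congˡ (+-congˡ (-‿cong balance)) ⟩
          _ ≈⟨ solve 5 (λ σ ρ M T₂ S₂ →
                 # 3 :* (# 2 :* (ρ :* ρ) :* M :- (# 2 :* σ :+ # 2 :* (ρ :* ρ :* M) :+ T₂ :- S₂))
                 := :- (# 6 :* σ :+ (T₂ :+ (# 2 :* T₂ :- # 3 :* S₂)))) refl slack ρ M T₂ S₂ ⟩
          - (ι 6 * slack + (T₂ + (ι 2 * T₂ - ι 3 * S₂))) ∎)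
        (NonNeg-ι 3 ⊗ (gap tight ⊗ M≥0))

    slack≤0 : slack ≤ 0#
    slack≤0 = ≤-by _ (deficit ⊕ NonNeg-ι 5 ⊗ slack≥0 ⊕ T₂≥0 ⊕ T-S-bound)
      (solve 3 (λ σ T S → # 0 :- σ
        := :- (# 6 :* σ :+ (T :+ (# 2 :* T :- # 3 :* S))) :+ # 5 :* σ :+ T :+ (# 2 :* T :- # 3 :* S))
        refl slack T₂ S₂)

    T₂≤0 : T₂ ≤ 0#
    T₂≤0 = ≤-by _ (deficit ⊕ NonNeg-ι 6 ⊗ slack≥0 ⊕ T-S-bound)
      (solve 3 (λ σ T S → # 0 :- T
        := :- (# 6 :* σ :+ (T :+ (# 2 :* T :- # 3 :* S))) :+ # 6 :* σ :+ (# 2 :* T :- # 3 :* S))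
        refl slack T₂ S₂)

    -- `balance` solved for `S₂`: all other terms are nonnegative once `e₂` is at most `2ρ²`. This
    -- later rules out edges of negative surplus.
    S₂≥0 : NonNeg S₂
    S₂≥0 = NonNeg-resp-≈
      (begin
        (ι 2 * (ρ * ρ) - e₂) * M + (ι 2 * slack + T₂)
          ≈⟨ solve 5 (λ e ρ M σ T → (# 2 :* (ρ :* ρ) :- e) :* M :+ (# 2 :* σ :+ T)
               := # 2 :* (ρ :* ρ) :* M :- e :* M :+ (# 2 :* σ :+ T)) refl e₂ ρ M slack T₂ ⟩
        ι 2 * (ρ * ρ) * M - e₂ * M + (ι 2 * slack + T₂)
          ≈⟨ +-congʳ (+-congˡ (-‿cong balance)) ⟩
        _ ≈⟨ solve 5 (λ ρ M σ T S → # 2 :* (ρ :* ρ) :* M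
               :- (# 2 :* σ :+ # 2 :* (ρ :* ρ :* M) :+ T :- S) :+ (# 2 :* σ :+ T) := S)
               refl ρ M slack T₂ S₂ ⟩
        S₂ ∎)
      (gap tight ⊗ M≥0 ⊕ (NonNeg-ι 2 ⊗ slack≥0 ⊕ T₂≥0))

    r>0 : Positive r
    r>0 q = 1-positive (NonNeg-resp-≈
      (solve 1 (λ r → :- r :+ (r :- # 1) := :- # 1) refl r) (q ⊕ r≥1))

    ρ>0 : Positive ρ
    ρ>0 q = r>0 (NonNeg-resp-≈
      (solve 2 (λ r ρ → :- ρ :+ (# 8 :* r :+ (ρ :- # 9 :* r)) := :- r) refl r ρ)
      (q ⊕ (NonNeg-ι 8 ⊗ r≥0 ⊕ ρ≥9r)))

    E≤0 : NonNeg (- E)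
    E≤0 = NonNeg-cancel ρ>0 (NonNeg-cancel (ι-positive 1) (NonNeg-resp-≈
      (solve 3 (λ ρ E K → # 0 :- (# 2 :* (ρ :* E) :+ K) :+ K := :- E :* ρ :* # 2) refl ρ E KP)
      (gap T₂≤0 ⊕ KP≥0)))

    pay≤0 : ∀ w → k w ≡ 1# → NonNeg (- pay w)
    pay≤0 w kw = NonNeg-resp-≈
      (begin
        (0# - T₂ + ι 2 * (ρ * E)) + (KP - k w * pay w)
          ≈⟨ +-congˡ (+-congˡ (-‿cong (*-congʳ (reflexive kw)))) ⟩
        (0# - T₂ + ι 2 * (ρ * E)) + (KP - 1# * pay w)
          ≈⟨ solve 4 (λ ρ E K p → (# 0 :- (# 2 :* (ρ :* E) :+ K) :+ # 2 :* (ρ :* E)) :+ (K :- # 1 :* p)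
               := :- p) refl ρ E KP (pay w) ⟩
        - pay w ∎)
      (gap T₂≤0 ⊕ NonNeg-ι 2 ⊗ (ρ≥0 ⊗ E≥0)
        ⊕ gap (term-≤-sum (λ i → k≥0 i ⊗ pay≥0 i) w))

    dW≤0 : ∀ w → k w ≡ 1# → NonNeg (- dW w)
    dW≤0 w kw = NonNeg-cancel y∗>0 (NonNeg-resp-≈
      (solve 4 (λ M dW dN y → :- (M :* dW :+ # 2 :* (dN :* (M :- y))) :+ # 2 :* (dN :* (M :- y))
        := :- dW :* M) refl M (dW w) (dN w) (y w))
      (pay≤0 w kw ⊕ NonNeg-ι 2 ⊗ (A-nonNeg h≥0 w ⊗ y≤y∗ w)))

    A-term : ∀ {u} → (∀ j → NonNeg (u j)) → ∀ i j → a i j ≡ 1# → NonNeg (A u i - u j)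
    A-term {u} u≥0 i j e = NonNeg-resp-≈
      (+-congˡ (-‿cong (trans (*-congʳ (reflexive e)) (*-identityˡ (u j)))))
      (gap (term-≤-sum (λ j → a≥0 i j ⊗ u≥0 j) j))

    far-far : ∀ u v → k u ≡ 1# → k v ≡ 1# → ¬ (a u v ≡ 1#)
    far-far u v ku kv uv = 1-positive (NonNeg-resp-≈
      (trans (solve 2 (λ d k → :- d :+ (d :- k) := :- k) refl (dW u) (k v)) (-‿cong (reflexive kv)))
      (dW≤0 u ku ⊕ A-term k≥0 u v uv))

    -- A neighbour in `N` makes `dN w` at least 1, so the vanishing `pay w` leaves no room for
    -- `y w < M`.
    far-maximal : ∀ w v → k w ≡ 1# → h v ≡ 1# → a w v ≡ 1# → NonNeg (y w - M)
    far-maximal w v kw hv wv = NonNeg-cancel (ι-positive 1) (NonNeg-resp-≈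
      (begin
        - pay w + (M * dW w + ι 2 * ((dN w - h v) * (M - y w)))
          ≈⟨ +-congˡ (+-congˡ (*-congˡ (*-congʳ (+-congˡ (-‿cong (reflexive hv)))))) ⟩
        _ ≈⟨ solve 4 (λ M dW dN y → :- (M :* dW :+ # 2 :* (dN :* (M :- y)))
               :+ (M :* dW :+ # 2 :* ((dN :- # 1) :* (M :- y)))
               := (y :- M) :* # 2) refl M (dW w) (dN w) (y w) ⟩
        (y w - M) * ι 2 ∎)
      (pay≤0 w kw ⊕ (M≥0 ⊗ A-nonNeg k≥0 w ⊕ NonNeg-ι 2 ⊗ (A-term h≥0 w v wv ⊗ y≤y∗ w))))

    -- No slack is left at `v`, hence `ρ y v ≥ A y v`, and `∗` is among the neighbours of `v`.
    near-positive : ∀ v → h v ≡ 1# → NonNeg (ρ * y v - M)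
    near-positive v hv = NonNeg-resp-≈
      (begin
        _ ≈⟨ +-congʳ (+-congʳ (+-congˡ (-‿cong (trans (*-congʳ (reflexive hv)) (*-identityˡ _))))) ⟩
        (slack - (A y v - ρ * y v)) + (0# - slack) + (A y v - M)
          ≈⟨ solve 4 (λ σ x z M → σ :- (x :- z) :+ (# 0 :- σ) :+ (x :- M) := z :- M)
               refl slack (A y v) (ρ * y v) M ⟩
        ρ * y v - M ∎)
      (NonNeg-resp-≈ (+-congʳ slack-terms)
         (gap (term-≤-sum (λ i → h≥0 i ⊗ subinvariant i) v))
        ⊕ gap slack≤0 ⊕ A-term y≥0 v ∗ (≡.trans (a-sym v ∗) hv))

    -- All neighbours of `w` lie in `N`, so `t w = A y w ≥ ρ M = P`: they already carry the whole
    -- weight of `N`. A vertex `v` missed by `w` would have weight zero, against `near-positive`.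
    near-far : ∀ v w → h v ≡ 1# → h w ≡ 0# → k w ≡ 1# → NonNeg (y w - M) → ¬ (a w v ≡ 0#)
    near-far v w hv hw kw yw wv = y∗>0 (NonNeg-resp-≈
      (solve 3 (λ ρ y M → ρ :* :- y :+ (ρ :* y :- M) := :- M) refl ρ (y v) M)
      (ρ≥0 ⊗ y≤0 ⊕ near-positive v hv))
      where
      t-small : NonNeg (P - t w - y v)
      t-small = NonNeg-resp-≈
        (begin
          _ ≈⟨ +-cong (sum-cong-≋ (λ j → solve 2 (λ a x → (# 1 :- a) :* x := x :- a :* x)
                 refl (a w j) (h j * y j)))
               (-‿cong (*-cong (+-congˡ (-‿cong (reflexive wv))) (*-congʳ (reflexive hv)))) ⟩
          _ ≈⟨ +-cong (sum-diff {n} _ _) (-‿cong (solve 1 (λ y → (# 1 :- # 0) :* (# 1 :* y) := y) refl (y v))) ⟩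
          P - t w - y v ∎)
        (gap (term-≤-sum (λ j → 1-a≥0 w j ⊗ hy≥0 j) v))
      y≤0 : NonNeg (- y v)
      y≤0 = NonNeg-resp-≈
        (begin
          _ ≈⟨ +-congʳ (+-congʳ (+-congʳ (+-congʳ (+-congʳ (+-congʳ
                 (trans (A-split y w) (+-congˡ (trans (*-congʳ (reflexive hw)) (zeroˡ M))))))))) ⟩
          _ ≈⟨ solve 8 (λ t s ρ y M dW P v →
                 t :+ s :+ # 0 :- ρ :* y :+ (M :* dW :- s) :+ M :* :- dW :+ (P :- t :- v)
                   :+ ρ :* (y :- M) :+ :- (P :- ρ :* M) := :- v)
                 refl (t w) (s w) ρ (y w) M (dW w) P (y v) ⟩
          - y v ∎)
        (subinvariant w ⊕ A-scaled k≥0 w ⊕ M≥0 ⊗ dW≤0 w kw ⊕ t-small ⊕ ρ≥0 ⊗ yw ⊕ E≤0)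

    module Complete (complete : ∀ v w → h v ≡ 1# → k w ≡ 1# → a v w ≡ 1#) where

      Q≤0 : ∀ v → h v ≡ 1# → NonNeg (- Q v)
      Q≤0 v hv = NonNeg-resp-≈
        (begin
          _ ≈⟨ sum-diff {n} _ _ ⟩
          s v - X ≈⟨ solve 2 (λ s X → s :- X := :- (X :- s)) refl (s v) X ⟩
          - Q v ∎)
        (sum-nonNeg λ j → pointwise j (classify j) (complete v j hv))
        where
        pointwise : ∀ j {d h k} → Class j d h k → (k ≡ 1# → a v j ≡ 1#) →
                    NonNeg (a v j * (k * y j) - k * y j)
        pointwise j centre _ = NonNeg-resp-≈
          (solve 2 (λ a y → # 0 := a :* (# 0 :* y) :- # 0 :* y) refl (a v j) (y j)) NonNeg-0
        pointwise j near _ = NonNeg-resp-≈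
          (solve 2 (λ a y → # 0 := a :* (# 0 :* y) :- # 0 :* y) refl (a v j) (y j)) NonNeg-0
        pointwise j far e = NonNeg-resp-≈
          (trans (solve 1 (λ y → # 0 := # 1 :* (# 1 :* y) :- # 1 :* y) refl (y j))
                 (+-congʳ (*-congʳ (sym (reflexive (e ≡.refl)))))) NonNeg-0

      -- With `Q u = Q v = 0`, `Q-sum` gives `X ≤ rM`. Then `neighbours` yields
      -- `9r (y u + y v) ≤ X + (3r + 1) M ≤ 5rM`.
      sparse : ∀ u v → h u ≡ 1# → h v ≡ 1# → a u v ≡ 1# →
               NonNeg (ι 5 * M - ι 9 * (y u + y v))
      sparse u v hu hv uv = NonNeg-cancel r>0 (NonNeg-resp-≈
        (solve 10 (λ X r M Au Av ρ yu yv Qu Qv →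
           (X :+ (# 3 :* r :+ # 1) :* M :- Au :- Av) :+ (r :- # 1) :* M
             :+ (Qu :+ Qv :- X :+ r :* M) :+ :- Qu :+ :- Qv
             :+ (Au :- ρ :* yu) :+ (Av :- ρ :* yv) :+ (ρ :- # 9 :* r) :* (yu :+ yv)
           := (# 5 :* M :- # 9 :* (yu :+ yv)) :* r)
           refl X r M (A y u) (A y v) ρ (y u) (y v) (Q u) (Q v))
        (neighbours ⊕ r≥1 ⊗ M≥0 ⊕ Q-sum ⊕ Q≤0 u hu ⊕ Q≤0 v hv
          ⊕ subinvariant u ⊕ subinvariant v ⊕ ρ≥9r ⊗ (y≥0 u ⊕ y≥0 v)))
        where open Pair u v hu hv uv

      -- By `sparse` every edge inside `N` has negative surplus, while `S₂ ≥ 0`. Adding `9 S₂` to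
      -- the sum of `5M − 9 (y u + y v)` over the ordered pairs cancels `Hd` and leaves `−4 M HH`.
      HH≤0 : NonNeg (- HH)
      HH≤0 = NonNeg-cancel y∗>0 (NonNeg-cancel (ι-positive 3) (NonNeg-resp-≈
        (begin
          ι 2 * sum (h · (g · dN)) + ι 5 * M * HH + ι 9 * S₂
            ≈⟨ +-congʳ (+-congʳ (*-congˡ (begin
                 _ ≈⟨ sum-cong-≋ (λ v → solve 3 (λ h y dN → h :* (:- # 9 :* y :* dN)
                        := :- # 9 :* (h :* (y :* dN))) refl (h v) (y v) (dN v)) ⟩
                 _ ≈⟨ *-distribˡ-sum (- ι 9) (h · (y · dN)) ⟨
                 - ι 9 * Hd ∎))) ⟩
          ι 2 * (- ι 9 * Hd) + ι 5 * M * HH + ι 9 * S₂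
            ≈⟨ solve 3 (λ Hd HH M → # 2 :* (:- # 9 :* Hd) :+ # 5 :* M :* HH :+ # 9 :* (# 2 :* Hd :- HH :* M)
                 := :- HH :* M :* # 4) refl Hd HH M ⟩
          - HH * M * ι 4 ∎)
        (pairs g (ι 5 * M) (λ u v hu hv uv → NonNeg-resp-≈
           (solve 3 (λ M yu yv → # 5 :* M :- # 9 :* (yu :+ yv)
              := :- # 9 :* yu :+ :- # 9 :* yv :+ # 5 :* M) refl M (y u) (y v))
           (sparse u v hu hv uv))
          ⊕ NonNeg-ι 9 ⊗ S₂≥0)))
        where
        g : Fin n → Carrier
        g v = - ι 9 * y v

      near-near : ∀ u v → h u ≡ 1# → h v ≡ 1# → ¬ (a u v ≡ 1#)
      near-near u v hu hv uv = 1-positive (NonNeg-resp-≈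
        (begin
          - HH + (HH - h u * dN u) + (dN u - h v)
            ≈⟨ +-cong (+-congˡ (+-congˡ (-‿cong (*-congʳ (reflexive hu))))) (+-congˡ (-‿cong (reflexive hv))) ⟩
          - HH + (HH - 1# * dN u) + (dN u - 1#)
            ≈⟨ solve 2 (λ H d → :- H :+ (H :- # 1 :* d) :+ (d :- # 1) := :- # 1) refl HH (dN u) ⟩
          - 1# ∎)
        (HH≤0 ⊕ gap (term-≤-sum (λ i → h≥0 i ⊗ A-nonNeg h≥0 i) u) ⊕ A-term h≥0 u v uv))

-- Books, common neighbours and candidate bipartitions.

lookup-injective : ∀ {A : Set} {xs : List A} → Unique xs → Injective _≡_ _≡_ (List.lookup xs)
lookup-injective (x∉ ∷ u) {zero}  {zero}  e = ≡.refl
lookup-injective (x∉ ∷ u) {zero}  {suc j} e = contradiction e (All.lookup x∉ (∈-lookup j))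
lookup-injective (x∉ ∷ u) {suc i} {zero}  e = contradiction (≡.sym e) (All.lookup x∉ (∈-lookup i))
lookup-injective (x∉ ∷ u) {suc i} {suc j} e = ≡.cong suc (lookup-injective u e)

module _ {n : ℕ} (G : Graph n) where
  open Graph G

  common? : ∀ u v → Decidable (λ j → u ~ j × v ~ j)
  common? u v j = (u ~? j) ×-dec (v ~? j)

  commonNeighbours : Fin n → Fin n → List (Fin n)
  commonNeighbours u v = filter (common? u v) (allFin n)

  many-common⇒book : ∀ {k u v} → u ~ v → k ℕ.≤ length (commonNeighbours u v) → book k ⊑ G
  many-common⇒book {k} {u} {v} uv k≤ = f , f-injective , f-edge _ _
    where
    apex : Fin k → Fin n
    apex i = List.lookup (commonNeighbours u v) (Fin.inject≤ i k≤)
    apex~ : ∀ i → u ~ apex i × v ~ apex i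
    apex~ i = All.lookup (all-filter (common? u v) (allFin n)) (∈-lookup (Fin.inject≤ i k≤))
    ~⇒≢ : ∀ {x y} → x ~ y → x ≢ y
    ~⇒≢ xy x≡y = ~-irrefl x≡y xy
    f : Fin (2 ℕ.+ k) → Fin n
    f zero          = u
    f (suc zero)    = v
    f (suc (suc i)) = apex i
    f-injective : Injective _≡_ _≡_ f
    f-injective {zero}        {zero}        e = ≡.refl
    f-injective {zero}        {suc zero}    e = contradiction e (~⇒≢ uv)
    f-injective {zero}        {suc (suc j)} e = contradiction e (~⇒≢ (proj₁ (apex~ j)))
    f-injective {suc zero}    {zero}        e = contradiction (≡.sym e) (~⇒≢ uv)
    f-injective {suc zero}    {suc zero}    e = ≡.refl
    f-injective {suc zero}    {suc (suc j)} e = contradiction e (~⇒≢ (proj₂ (apex~ j)))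
    f-injective {suc (suc i)} {zero}        e = contradiction (≡.sym e) (~⇒≢ (proj₁ (apex~ i)))
    f-injective {suc (suc i)} {suc zero}    e = contradiction (≡.sym e) (~⇒≢ (proj₂ (apex~ i)))
    f-injective {suc (suc i)} {suc (suc j)} e = ≡.cong (λ i → Fin.suc (suc i))
      (Fin.inject≤-injective k≤ k≤ i j
        (lookup-injective (Unique.filter⁺ (common? u v) (Unique.allFin⁺ n)) e))
    f-edge : ∀ i j → Graph._~_ (book k) i j → f i ~ f j
    f-edge zero          zero          (i≢j , _) = contradiction ≡.refl i≢j
    f-edge zero          (suc zero)    _ = uv
    f-edge zero          (suc (suc j)) _ = proj₁ (apex~ j)
    f-edge (suc zero)    zero          _ = ~-sym uv
    f-edge (suc zero)    (suc zero)    (i≢j , _) = contradiction ≡.refl i≢j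
    f-edge (suc zero)    (suc (suc j)) _ = proj₂ (apex~ j)
    f-edge (suc (suc i)) zero          _ = ~-sym (proj₁ (apex~ i))
    f-edge (suc (suc i)) (suc zero)    _ = ~-sym (proj₂ (apex~ i))
    f-edge (suc (suc i)) (suc (suc j)) (_ , inj₁ (ℕ.s≤s (ℕ.s≤s ())))
    f-edge (suc (suc i)) (suc (suc j)) (_ , inj₂ (ℕ.s≤s (ℕ.s≤s ())))

  IsEdge : Fin n × Fin n → Set
  IsEdge (i , j) = i Fin.< j × i ~ j

  edge? : Decidable IsEdge
  edge? (i , j) = (i Fin.<? j) ×-dec (i ~? j)

  edge-exists : 0 ℕ.< numEdges G → ∃ λ u → ∃ λ v → u ~ v
  edge-exists 0<m = go (edges G) 0<m (all-filter edge? (cartesianProduct (allFin n) (allFin n)))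
    where
    go : ∀ es → 0 ℕ.< length es → All IsEdge es → ∃ λ u → ∃ λ v → u ~ v
    go (_ ∷ _) _ ((_ , uv) All.∷ _) = _ , _ , uv

  bookFree⇒few-common : ∀ {k u v} → BookFree (k ℕ.+ 1) G → u ~ v →
                        length (commonNeighbours u v) ℕ.≤ k
  bookFree⇒few-common {k} {u} {v} free uv = ℕ.≮⇒≥ λ k< →
    free (many-common⇒book uv (≡.subst (ℕ._≤ length (commonNeighbours u v)) (≡.sym (ℕ.+-comm k 1)) k<))

  bipartitionFrom : Fin n → Fin n → Bool
  bipartitionFrom u v = does (u ~? v)

  -- A vertex and its neighbours determine the only candidate bipartition, which makes
  -- being complete bipartite decidable.
  Bipartitioned : Fin n → Set
  Bipartitioned u = ∀ v w →
    (v ~ w → bipartitionFrom u v ≢ bipartitionFrom u w) ×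
    (bipartitionFrom u v ≢ bipartitionFrom u w → v ~ w)

  bipartitioned? : Decidable Bipartitioned
  bipartitioned? u = Fin.all? λ v → Fin.all? λ w →
    let c≢? = ¬? (bipartitionFrom u v Bool.≟ bipartitionFrom u w)
    in (v ~? w →-dec c≢?) ×-dec (c≢? →-dec v ~? w)

  bipartitioned⇒completeBipartite : ∀ {u v} → u ~ v → Bipartitioned u → CompleteBipartite G
  bipartitioned⇒completeBipartite {u} {v} uv b = bipartitionFrom u , surjective ,
    λ x y → mk⇔ (proj₁ (b x y)) (proj₂ (b x y))
    where
    surjective : Surjective _≡_ _≡_ (bipartitionFrom u)
    surjective true  = v , λ { ≡.refl → dec-true (u ~? v) uv }
    surjective false = u , λ { ≡.refl → dec-false (u ~? u) (~-irrefl ≡.refl) }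

-- Adjacency matrices over an ordered ring.

module Matrices (R : OrderedRing) where
  open OrderedRing R renaming (refl to ≈-refl; sym to ≈-sym; trans to ≈-trans)
  open OrderedRingProperties R
  open Sums R
  open import Algebra.Properties.Semiring.Mult.TCOptimised semiring using (1+×; ×-homo-+; ×1-homo-*)
  open import Relation.Binary.Reasoning.Setoid setoid

  [_] : {P : Set} → Dec P → Carrier
  [ d ] = if does d then 1# else 0#

  [yes] : ∀ {P : Set} (d : Dec P) → P → [ d ] ≡ 1#
  [yes] d p = ≡.cong (if_then 1# else 0#) (dec-true d p)

  [no] : ∀ {P : Set} (d : Dec P) → ¬ P → [ d ] ≡ 0#
  [no] d ¬p = ≡.cong (if_then 1# else 0#) (dec-false d ¬p)

  [×] : ∀ {P Q : Set} (d : Dec P) (e : Dec Q) → [ d ×-dec e ] ≈ [ d ] * [ e ]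
  [×] (yes _) e = ≈-sym (*-identityˡ _)
  [×] (no _)  e = ≈-sym (zeroˡ _)

  listSum : {A : Set} → (A → Carrier) → List A → Carrier
  listSum f []       = 0#
  listSum f (x ∷ xs) = f x + listSum f xs

  length-filter : ∀ {A : Set} {P : A → Set} (P? : Decidable P) xs →
    ι (length (filter P? xs)) ≈ listSum (λ x → [ P? x ]) xs
  length-filter P? [] = ≈-refl
  length-filter P? (x ∷ xs) with does (P? x)
  ... | true  = ≈-trans (1+× (length (filter P? xs)) 1#) (+-congˡ (length-filter P? xs))
  ... | false = ≈-trans (length-filter P? xs) (≈-sym (+-identityˡ _))

  listSum-tabulate : ∀ {A : Set} {n} (f : A → Carrier) (g : Fin n → A) →
    listSum f (tabulate g) ≈ sum (f ∘ g)
  listSum-tabulate {n = zero}  f g = ≈-refl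
  listSum-tabulate {n = suc n} f g = +-congˡ (listSum-tabulate f (g ∘ suc))

  listSum-map-++ : ∀ {A B : Set} (f : B → Carrier) (g : A → B) xs ys →
    listSum f (List.map g xs ++ ys) ≈ listSum (f ∘ g) xs + listSum f ys
  listSum-map-++ f g []       ys = ≈-sym (+-identityˡ _)
  listSum-map-++ f g (x ∷ xs) ys =
    ≈-trans (+-congˡ (listSum-map-++ f g xs ys)) (≈-sym (+-assoc _ _ _))

  listSum-cartesianProduct : ∀ {A B : Set} (f : A × B → Carrier) xs ys →
    listSum f (cartesianProduct xs ys) ≈ listSum (λ x → listSum (λ y → f (x , y)) ys) xs
  listSum-cartesianProduct f []       ys = ≈-refl
  listSum-cartesianProduct f (x ∷ xs) ys = ≈-trans (listSum-map-++ f (x ,_) ys _)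
    (+-congˡ (listSum-cartesianProduct f xs ys))

  ¬¬-choice : ∀ {n} {P : Fin n → Set} → (∀ i → ¬ ¬ P i) → ¬ ¬ (∀ i → P i)
  ¬¬-choice {zero}  p k = k λ ()
  ¬¬-choice {suc n} p k = p zero λ p₀ → ¬¬-choice (p ∘ suc) λ ps →
    k λ { zero → p₀ ; (suc i) → ps i }

  -- A maximiser cannot be computed, since finding it would decide inequalities; its existence under
  -- double negation is enough for stable goals.
  ¬¬-max : ∀ {n} (y : Fin n → Carrier) → Fin n → ¬ ¬ (∃ λ ∗ → ∀ i → y i ≤ y ∗)
  ¬¬-max {suc zero}    y _ k = k (zero , λ { zero → ≤-refl })
  ¬¬-max {suc (suc n)} y _ k = ¬¬-max (y ∘ suc) zero λ (∗ , max) →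
    let tail≤ : ¬ (y zero ≤ y (suc ∗))
        tail≤ p = k (suc ∗ , λ { zero → p ; (suc i) → max i })
    in k (zero , λ { zero → ≤-refl ; (suc i) → ≤-trans (max i) (≤-total tail≤) })

  -- A relation and not a function: `either` amounts to knowing the sign of `x`, which is available
  -- only under double negation.
  record IsAbs (x ∣x∣ : Carrier) : Set where
    field
      nonNeg : NonNeg ∣x∣
      x≤     : NonNeg (∣x∣ - x)
      -x≤    : NonNeg (∣x∣ + x)
      either : ∣x∣ ≈ x ⊎ ∣x∣ ≈ - x

  ¬¬-abs : ∀ x → ¬ ¬ (∃ λ ∣x∣ → IsAbs x ∣x∣)
  ¬¬-abs x k = k (- x , record
    { nonNeg = x≤0
    ; x≤     = NonNeg-+ x≤0 x≤0
    ; -x≤    = NonNeg-resp-≈ (solve 1 (λ x → # 0 := :- x :+ x) ≈-refl x) NonNeg-0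
    ; either = inj₂ ≈-refl })
    where
    x≤0 : NonNeg (- x)
    x≤0 = NonNeg-total λ x≥0 → k (x , record
      { nonNeg = x≥0
      ; x≤     = NonNeg-resp-≈ (solve 1 (λ x → # 0 := x :- x) ≈-refl x) NonNeg-0
      ; -x≤    = NonNeg-+ x≥0 x≥0
      ; either = inj₁ ≈-refl })

  IsEigenvector : ∀ {n} → (Fin n → Fin n → Carrier) → Carrier → (Fin n → Carrier) → Set
  IsEigenvector a μ x = ¬ (∀ i → x i ≈ 0#) × (∀ i → sum (λ j → a i j * x j) ≈ μ * x i)

  eigenvector-cong : ∀ {n} {a b : Fin n → Fin n → Carrier} {μ x} →
    (∀ i j → a i j ≡ b i j) → IsEigenvector a μ x → IsEigenvector b μ x
  eigenvector-cong {x = x} a≡b (nonzero , eigen) = nonzero , λ i → ≈-trans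
    (sum-cong-≋ λ j → *-congʳ (reflexive (≡.sym (a≡b i j)))) (eigen i)

  module Adjacency {n : ℕ} (G : Graph n) where
    open Graph G

    a : Fin n → Fin n → Carrier
    a i j = if does (i ~? j) then 1# else 0#

    a-sym : ∀ i j → a i j ≡ a j i
    a-sym i j with i ~? j
    ... | yes ij = ≡.sym ([yes] (j ~? i) (~-sym ij))
    ... | no ¬ij = ≡.sym ([no] (j ~? i) (¬ij ∘ ~-sym))

    a-01 : ∀ i j → a i j ≡ 0# ⊎ a i j ≡ 1#
    a-01 i j with does (i ~? j)
    ... | true  = inj₂ ≡.refl
    ... | false = inj₁ ≡.refl

    a-irr : ∀ i → a i i ≡ 0#
    a-irr i = [no] (i ~? i) (~-irrefl ≡.refl)

    0≢1 : ¬ (0# ≡ 1#)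
    0≢1 e = 1-positive (NonNeg-resp-≈
      (≈-trans (solve 0 (# 0 := :- # 0) ≈-refl) (-‿cong (reflexive e))) NonNeg-0)

    a≡1⇒~ : ∀ {i j} → a i j ≡ 1# → i ~ j
    a≡1⇒~ {i} {j} e with i ~? j
    ... | yes ij = ij
    ... | no _   = contradiction e 0≢1

    a-yes : ∀ {i j} → i ~ j → a i j ≡ 1#
    a-yes {i} {j} = [yes] (i ~? j)

    a-no : ∀ {i j} → ¬ i ~ j → a i j ≡ 0#
    a-no {i} {j} = [no] (i ~? j)

    degreeSum : sum (λ i → sum (a i)) ≈ ι 2 * ι (numEdges G)
    degreeSum = begin
      sum (λ i → sum (a i))
        ≈⟨ sum-cong-≋ (λ i → ≈-trans (sum-cong-≋ (orient i)) (∑-distrib-+ (b i) (λ j → b j i))) ⟩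
      sum (λ i → sum (b i) + sum (λ j → b j i))
        ≈⟨ ∑-distrib-+ (λ i → sum (b i)) (λ i → sum (λ j → b j i)) ⟩
      sum (λ i → sum (b i)) + sum (λ i → sum (λ j → b j i))
        ≈⟨ +-congˡ (∑-comm (λ i j → b j i)) ⟩
      sum (λ i → sum (b i)) + sum (λ i → sum (b i))
        ≈⟨ solve 1 (λ x → x :+ x := # 2 :* x) ≈-refl _ ⟩
      ι 2 * sum (λ i → sum (b i))
        ≈⟨ *-congˡ count ⟨
      ι 2 * ι (numEdges G) ∎
      where
      b : Fin n → Fin n → Carrier
      b i j = [ edge? G (i , j) ]
      orient : ∀ i j → a i j ≈ b i j + b j i
      orient i j = go (i ~? j) (Fin.<-cmp i j)
        where
        values : ∀ {x y z} → a i j ≡ x → b i j ≡ y → b j i ≡ z → x ≈ y + z → a i j ≈ b i j + b j i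
        values ≡.refl ≡.refl ≡.refl e = e
        go : Dec (i ~ j) → Tri (i Fin.< j) (i ≡ j) (j Fin.< i) → a i j ≈ b i j + b j i
        go (no ¬ij) _ = values (a-no ¬ij)
          ([no] (edge? G (i , j)) (¬ij ∘ proj₂))
          ([no] (edge? G (j , i)) (¬ij ∘ ~-sym ∘ proj₂)) (≈-sym (+-identityˡ 0#))
        go (yes ij) (tri< i<j _ i≯j) = values (a-yes ij)
          ([yes] (edge? G (i , j)) (i<j , ij))
          ([no] (edge? G (j , i)) (i≯j ∘ proj₁)) (≈-sym (+-identityʳ 1#))
        go (yes ij) (tri≈ _ i≡j _) = contradiction ij (~-irrefl i≡j)
        go (yes ij) (tri> i≮j _ i>j) = values (a-yes ij)
          ([no] (edge? G (i , j)) (i≮j ∘ proj₁))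
          ([yes] (edge? G (j , i)) (i>j , ~-sym ij)) (≈-sym (+-identityˡ 1#))
      count : ι (numEdges G) ≈ sum (λ i → sum (b i))
      count = begin
        ι (numEdges G)
          ≈⟨ length-filter (edge? G) (cartesianProduct (allFin n) (allFin n)) ⟩
        listSum (λ e → [ edge? G e ]) (cartesianProduct (allFin n) (allFin n))
          ≈⟨ listSum-cartesianProduct (λ e → [ edge? G e ]) (allFin n) (allFin n) ⟩
        listSum (λ i → listSum (b i) (allFin n)) (allFin n)
          ≈⟨ listSum-tabulate (λ i → listSum (b i) (allFin n)) id ⟩
        sum (λ i → listSum (b i) (allFin n))
          ≈⟨ sum-cong-≋ (λ i → listSum-tabulate (b i) id) ⟩
        sum (λ i → sum (b i)) ∎

    codegree : ∀ u v → sum (λ j → a u j * a v j) ≈ ι (length (commonNeighbours G u v))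
    codegree u v = begin
      sum (λ j → a u j * a v j)
        ≈⟨ sum-cong-≋ (λ j → [×] (u ~? j) (v ~? j)) ⟨
      sum (λ j → [ common? G u v j ])
        ≈⟨ listSum-tabulate (λ j → [ common? G u v j ]) id ⟨
      listSum (λ j → [ common? G u v j ]) (allFin n)
        ≈⟨ length-filter (common? G u v) (allFin n) ⟨
      ι (length (commonNeighbours G u v)) ∎

    m : ℕ
    m = numEdges G

    -- From an eigenvector to the bound and to the structure of extremal graphs.

    module Spectral (connected : Connected G) {r : ℕ} (1≤r : 1 ℕ.≤ r) (free : BookFree (r ℕ.+ 1) G)
        {ρ : Carrier} (ρ≥9r : NonNeg (ρ - ι 9 * ι r))
        {z : Fin n → Carrier} (eigen : IsEigenvector a ρ z) where

      r≥1 : NonNeg (ι r - 1#)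
      r≥1 = gap (ι-mono 1≤r)

      ρ≥0 : NonNeg ρ
      ρ≥0 = NonNeg-resp-≈ (solve 2 (λ ρ r → ρ :- # 9 :* r :+ # 9 :* r := ρ) ≈-refl ρ (ι r))
              (NonNeg-+ ρ≥9r (NonNeg-* (NonNeg-ι 9) (NonNeg-ι r)))

      -- The signs of the entries and the position of the maximum exist only under double negation,
      -- so the vector is handed to a continuation that ends in a contradiction. The two equations
      -- recover the matrix and the eigenvalue by matching.
      ¬¬-subinvariantVector : ∀ {Goal : Set} → ((H : SubinvariantVector R n) →
        SubinvariantVector.a H ≡ a → SubinvariantVector.ρ H ≡ ρ → ¬ Goal) → ¬ Goal
      ¬¬-subinvariantVector {Goal} use goal = ¬¬-choice (λ i → ¬¬-abs (z i)) λ abs →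
        let y = λ i → proj₁ (abs i)
            module y i = IsAbs (proj₂ (abs i))
        in ¬¬-start λ i₀ → ¬¬-max y i₀ λ (∗ , max) →
        use (record
          { a        = a
          ; a-sym    = a-sym
          ; a-01     = a-01
          ; a-irr    = a-irr
          ; r        = ι r
          ; r≥1      = r≥1
          ; codegree = λ u v e → ≤-trans (≤-reflexive (codegree u v))
                                   (ι-mono (bookFree⇒few-common G free (a≡1⇒~ e)))
          ; ρ        = ρ
          ; ρ≥9r     = ρ≥9r
          ; ∗        = ∗
          ; y        = y
          ; y≥0      = y.nonNeg
          ; y≤y∗     = λ i → gap (max i)
          ; y∗>0     = λ y∗≤0 → proj₁ eigen λ i → vanish (proj₂ (abs i)) (gap (max i)) y∗≤0
          ; subinvariant = λ i → subinvariant abs i (y.either i)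
          }) ≡.refl ≡.refl goal
        where
        ¬¬-start : ¬ ¬ Fin n
        ¬¬-start k = proj₁ eigen λ i → contradiction i k

        vanish : ∀ {x ∣x∣ M} → IsAbs x ∣x∣ → NonNeg (M - ∣x∣) → NonNeg (- M) → x ≈ 0#
        vanish {x} {∣x∣} {M} is-abs ≤M M≤0 = NonNeg-antisym
          (NonNeg-resp-≈ (solve 3 (λ x u M → u :+ x :+ (M :- u) :+ :- M := x) ≈-refl x ∣x∣ M)
            (NonNeg-+ (NonNeg-+ (IsAbs.-x≤ is-abs) ≤M) M≤0))
          (NonNeg-resp-≈ (solve 3 (λ x u M → u :- x :+ (M :- u) :+ :- M := :- x) ≈-refl x ∣x∣ M)
            (NonNeg-+ (NonNeg-+ (IsAbs.x≤ is-abs) ≤M) M≤0))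

        -- The triangle inequality: `ρ y i` is `ρ z i` up to sign, and with either sign the sum of
        -- `a i j * z j` is at most that of `a i j * y j`.
        subinvariant : (abs : ∀ i → ∃ (IsAbs (z i))) → let y = λ i → proj₁ (abs i) in
          ∀ i → y i ≈ z i ⊎ y i ≈ - z i → NonNeg (sum (λ j → a i j * y j) - ρ * y i)
        subinvariant abs i sign = finish sign
          where
          y : Fin n → Carrier
          y j = proj₁ (abs j)
          Σay Σaz : Carrier
          Σay = sum (λ j → a i j * y j)
          Σaz = sum (λ j → a i j * z j)
          a≥0 : ∀ j → NonNeg (a i j)
          a≥0 j with a-01 i j
          ... | inj₁ e = ≡.subst NonNeg (≡.sym e) NonNeg-0
          ... | inj₂ e = ≡.subst NonNeg (≡.sym e) NonNeg-1
          dominates : ∀ σ → (∀ j → NonNeg (y j + σ * z j)) → NonNeg (Σay + σ * Σaz)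
          dominates σ p = NonNeg-resp-≈
            (begin
              sum (λ j → a i j * (y j + σ * z j))
                ≈⟨ sum-cong-≋ (λ j → solve 4 (λ a y σ z → a :* (y :+ σ :* z)
                     := # 1 :* (a :* y) :+ σ :* (a :* z)) ≈-refl (a i j) (y j) σ (z j)) ⟩
              _ ≈⟨ sum-lin₂ 1# σ (λ j → a i j * y j) (λ j → a i j * z j) ⟩
              _ ≈⟨ +-congʳ (*-identityˡ Σay) ⟩
              Σay + σ * Σaz ∎)
            (sum-nonNeg λ j → NonNeg-* (a≥0 j) (p j))
          finish : y i ≈ z i ⊎ y i ≈ - z i → NonNeg (Σay - ρ * y i)
          finish (inj₁ e) = NonNeg-resp-≈
            (begin
              Σay + - 1# * Σaz      ≈⟨ +-congˡ (*-congˡ (proj₂ eigen i)) ⟩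
              Σay + - 1# * (ρ * z i) ≈⟨ +-congˡ (*-congˡ (*-congˡ (≈-sym e))) ⟩
              Σay + - 1# * (ρ * y i) ≈⟨ solve 2 (λ s t → s :+ :- # 1 :* t := s :- t) ≈-refl Σay (ρ * y i) ⟩
              Σay - ρ * y i ∎)
            (dominates (- 1#) λ j → NonNeg-resp-≈
              (solve 2 (λ y z → y :- z := y :+ :- # 1 :* z) ≈-refl (y j) (z j)) (IsAbs.x≤ (proj₂ (abs j))))
          finish (inj₂ e) = NonNeg-resp-≈
            (begin
              Σay + 1# * Σaz          ≈⟨ +-congˡ (*-congˡ (proj₂ eigen i)) ⟩
              Σay + 1# * (ρ * z i)    ≈⟨ solve 3 (λ s ρ z → s :+ # 1 :* (ρ :* z) := s :- ρ :* :- z) ≈-refl Σay ρ (z i) ⟩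
              Σay - ρ * - z i         ≈⟨ +-congˡ (-‿cong (*-congˡ (≈-sym e))) ⟩
              Σay - ρ * y i ∎)
            (dominates 1# λ j → NonNeg-resp-≈
              (solve 2 (λ y z → y :+ z := y :+ # 1 :* z) ≈-refl (y j) (z j)) (IsAbs.-x≤ (proj₂ (abs j))))

      ρ²≤m : ρ * ρ ≤ ι m
      ρ²≤m = ≤-stable (¬¬-subinvariantVector λ { H ≡.refl ≡.refl ρ²≰m → ρ²≰m (*-cancelʳ-≤ (ι 2) (ι-positive 1)
        (≤-resp (solve 1 (λ x → # 2 :* x := x :* # 2) ≈-refl (ρ * ρ))
                (≈-trans degreeSum (solve 1 (λ x → # 2 :* x := x :* # 2) ≈-refl (ι m)))
                (SpectralBound.ρ²-bound R H))) })

      equality⇒completeBipartite : ∀ {u v} → u ~ v → ι m ≤ ρ * ρ → CompleteBipartite G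
      equality⇒completeBipartite {u} {v} uv m≤ρ² = finish
        (decidable-stable (Fin.any? (bipartitioned? G)) (¬¬-subinvariantVector found))
        where
        finish : ∃ (Bipartitioned G) → CompleteBipartite G
        finish (c , b) = bipartitioned⇒completeBipartite G (proj₂ (neighbour c)) b
          where
          neighbour : ∀ w → ∃ λ x → w ~ x
          neighbour w with connected w u
          ... | Star.ε        = v , uv
          ... | wx ◅ _   = _ , wx

        found : (H : SubinvariantVector R n) → SubinvariantVector.a H ≡ a →
          SubinvariantVector.ρ H ≡ ρ → ¬ ¬ (∃ (Bipartitioned G))
        -- The sides are `N` and `W` together with `∗`; this is the bipartition read off from `∗`.
        found H ≡.refl ≡.refl none = none (∗ , λ v w → edge⇒ v w , λ c → ⇒edge v w c)
          where
          open SubinvariantVector H using (∗) renaming (a-01 to edge-01)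
          open SpectralBound R H using (h; k; module Tight)
          open Tight (≤-resp (≈-sym degreeSum) ≈-refl
            (≤-by _ (NonNeg-* (NonNeg-ι 2) (gap m≤ρ²))
              (solve 2 (λ x y → # 2 :* x :- # 2 :* y := # 2 :* (x :- y)) ≈-refl (ρ * ρ) (ι m))))

          far-k : ∀ {w} → w ≢ ∗ → ¬ ∗ ~ w → k w ≡ 1#
          far-k {w} w≢∗ ≁ with w Fin.≟ ∗
          ... | yes w≡∗ = contradiction w≡∗ w≢∗
          ... | no _ with edge-01 ∗ w
          ...   | inj₁ _ = ≡.refl
          ...   | inj₂ e = contradiction (a≡1⇒~ e) ≁

          -- The first step of a path from `w` to `∗` cannot stay in `W`, which is independent, and
          -- cannot reach `∗`, which is not adjacent to `w`. So it enters `N`.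
          near-neighbour : ∀ w → w ≢ ∗ → ¬ ∗ ~ w → ∃ λ v → ∗ ~ v × w ~ v
          near-neighbour w w≢∗ ≁ with connected w ∗
          ... | Star.ε = contradiction ≡.refl w≢∗
          ... | _◅_ {j = v} wv _ with ∗ ~? v
          ...   | yes ∗v = v , ∗v , wv
          ...   | no ∗≁v with v Fin.≟ ∗
          ...     | yes ≡.refl = contradiction (~-sym wv) ≁
          ...     | no v≢∗ = contradiction (a-yes wv)
                               (far-far w v (far-k w≢∗ ≁) (far-k v≢∗ ∗≁v))

          near-far-edge : ∀ v w → ∗ ~ v → w ≢ ∗ → ¬ ∗ ~ w → v ~ w
          near-far-edge v w ∗v w≢∗ ≁ with near-neighbour w w≢∗ ≁ | v ~? w
          ... | _ | yes vw = vw
          ... | x , ∗x , wx | no ≁vw = contradiction (a-no (≁vw ∘ ~-sym))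
            (near-far v w (a-yes ∗v) (a-no ≁) (far-k w≢∗ ≁)
              (far-maximal w x (far-k w≢∗ ≁) (a-yes ∗x) (a-yes wx)))

          across : ∀ v w → ∗ ~ v → ¬ ∗ ~ w → v ~ w
          across v w ∗v ∗≁w with w Fin.≟ ∗
          ... | yes ≡.refl = ~-sym ∗v
          ... | no w≢∗   = near-far-edge v w ∗v w≢∗ ∗≁w

          complete : ∀ v w → h v ≡ 1# → k w ≡ 1# → a v w ≡ 1#
          complete v w hv kw = a-yes (across v w (a≡1⇒~ hv) (k⇒≁ kw))
            where
            k⇒≁ : k w ≡ 1# → ¬ ∗ ~ w
            k⇒≁ kw ∗w with w Fin.≟ ∗
            ... | yes _ = 0≢1 kw
            ... | no _ with edge-01 ∗ w
            ...   | inj₁ e = 0≢1 (≡.trans (≡.sym e) (a-yes ∗w))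
            ...   | inj₂ _ = 0≢1 kw

          open Complete complete

          ⇒edge : ∀ v w → bipartitionFrom G ∗ v ≢ bipartitionFrom G ∗ w → v ~ w
          ⇒edge v w c≢ with ∗ ~? v | ∗ ~? w
          ... | yes _  | yes _  = contradiction ≡.refl c≢
          ... | no _   | no _   = contradiction ≡.refl c≢
          ... | yes ∗v | no ∗≁w = across v w ∗v ∗≁w
          ... | no ∗≁v | yes ∗w = ~-sym (across w v ∗w ∗≁v)

          edge⇒ : ∀ v w → v ~ w → bipartitionFrom G ∗ v ≢ bipartitionFrom G ∗ w
          edge⇒ v w vw c≡ with ∗ ~? v | ∗ ~? w
          ... | yes ∗v | yes ∗w = near-near v w (a-yes ∗v) (a-yes ∗w) (a-yes vw)
          ... | yes _  | no _   = contradiction c≡ λ ()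
          ... | no _   | yes _  = contradiction c≡ λ ()
          ... | no ∗≁v | no ∗≁w with v Fin.≟ ∗ | w Fin.≟ ∗
          ...   | yes ≡.refl | _        = ∗≁w vw
          ...   | no _     | yes ≡.refl = ∗≁v (~-sym vw)
          ...   | no v≢∗   | no w≢∗   = far-far v w (far-k v≢∗ ∗≁v) (far-k w≢∗ ∗≁w) (a-yes vw)

    -- The eigenvalue of a complete bipartite graph.

    module FromBipartite (c : Fin n → Bool) (onto : Surjective _≡_ _≡_ c)
        (cut : ∀ u v → u ~ v ⇔ c u ≢ c v) (√m : Carrier) (√m² : √m * √m ≈ ι m) where

      agree : Bool → Bool → Carrier
      agree true  b = if b then 1# else 0#
      agree false b = if b then 0# else 1#

      side : Bool → Fin n → Carrier
      side b i = agree b (c i)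

      size : Bool → Carrier
      size b = sum (side b)

      a-side : ∀ i j → a i j ≡ side (not (c i)) j
      a-side i j with i ~? j
      a-side i j | yes ij with c i | c j | Equivalence.to (cut i j) ij
      ... | true  | true  | c≢ = contradiction ≡.refl c≢
      ... | true  | false | c≢ = ≡.refl
      ... | false | true  | c≢ = ≡.refl
      ... | false | false | c≢ = contradiction ≡.refl c≢
      a-side i j | no ≁ with c i | c j | ≁ ∘ Equivalence.from (cut i j)
      ... | true  | true  | c≡ = ≡.refl
      ... | true  | false | c≡ = contradiction (λ ()) c≡
      ... | false | true  | c≡ = contradiction (λ ()) c≡
      ... | false | false | c≡ = ≡.refl

      row-sum : ∀ i → sum (a i) ≈ size (not (c i))
      row-sum i = sum-cong-≋ λ j → reflexive (a-side i j)

      m-product : ι m ≈ size true * size false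
      m-product = *-cancelˡ-2 (begin
        ι 2 * ι m
          ≈⟨ degreeSum ⟨
        sum (λ i → sum (a i))
          ≈⟨ sum-cong-≋ (λ i → ≈-trans (row-sum i) (by-side i)) ⟩
        sum (λ i → size false * side true i + size true * side false i)
          ≈⟨ sum-lin₂ (size false) (size true) (side true) (side false) ⟩
        size false * size true + size true * size false
          ≈⟨ solve 2 (λ p q → q :* p :+ p :* q := # 2 :* (p :* q)) ≈-refl (size true) (size false) ⟩
        ι 2 * (size true * size false) ∎)
        where
        by-side : ∀ i → size (not (c i)) ≈ size false * side true i + size true * side false i
        by-side i with c i
        ... | true  = solve 2 (λ p q → q := q :* # 1 :+ p :* # 0) ≈-refl (size true) (size false)
        ... | false = solve 2 (λ p q → p := q :* # 0 :+ p :* # 1) ≈-refl (size true) (size false)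
        *-cancelˡ-2 : ∀ {x y} → ι 2 * x ≈ ι 2 * y → x ≈ y
        *-cancelˡ-2 {x} {y} e = ≤-antisym
          (*-cancelʳ-≤ (ι 2) (ι-positive 1) (≤-resp (comm x) (comm y) (≤-reflexive e)))
          (*-cancelʳ-≤ (ι 2) (ι-positive 1) (≤-resp (comm y) (comm x) (≤-reflexive (≈-sym e))))
          where
          comm : ∀ x → ι 2 * x ≈ x * ι 2
          comm = solve 1 (λ x → # 2 :* x := x :* # 2) ≈-refl

      -- With sides of sizes `p` and `q`, where `p q = m`, an eigenvector for `√m` constant on the
      -- sides has values in the ratio `√m : p`. This scaling avoids division.
      weight : Bool → Carrier
      weight true  = √m
      weight false = size true

      vector : Fin n → Carrier
      vector i = weight (c i)

      side-vector : ∀ b j → side b j * vector j ≈ side b j * weight b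
      side-vector true j with c j
      ... | true  = ≈-refl
      ... | false = ≈-trans (zeroˡ _) (≈-sym (zeroˡ _))
      side-vector false j with c j
      ... | true  = ≈-trans (zeroˡ _) (≈-sym (zeroˡ _))
      ... | false = ≈-refl

      side-nonNeg : ∀ b j → NonNeg (side b j)
      side-nonNeg true j with c j
      ... | true  = NonNeg-1
      ... | false = NonNeg-0
      side-nonNeg false j with c j
      ... | true  = NonNeg-0
      ... | false = NonNeg-1

      size-weight : ∀ b → size (not b) * weight (not b) ≈ √m * weight b
      size-weight true = begin
        size false * size true ≈⟨ solve 2 (λ p q → q :* p := p :* q) ≈-refl (size true) (size false) ⟩
        size true * size false ≈⟨ m-product ⟨
        ι m                    ≈⟨ √m² ⟨
        √m * √m                ∎
      size-weight false = solve 2 (λ p s → p :* s := s :* p) ≈-refl (size true) √m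

      eigenvector : ∀ {A} → (∀ i j → A i j ≡ a i j) → IsEigenvector A √m vector
      eigenvector {A} A≡a = nonzero , λ i → begin
        sum (λ j → A i j * vector j)
          ≈⟨ sum-cong-≋ (λ j → ≈-trans (*-congʳ (reflexive (≡.trans (A≡a i j) (a-side i j)))) (side-vector (not (c i)) j)) ⟩
        sum (λ j → side (not (c i)) j * weight (not (c i)))
          ≈⟨ *-distribʳ-sum (weight (not (c i))) (side (not (c i))) ⟨
        size (not (c i)) * weight (not (c i))
          ≈⟨ size-weight (c i) ⟩
        √m * vector i ∎
        where
        nonzero : ¬ (∀ i → vector i ≈ 0#)
        nonzero zero-vector with onto true | onto false
        -- The entry at `v` on the false side is `size true`, which is at least 1 because `u` lies
        -- on the true side.
        ... | u , cu | v , cv = 1-positive (NonNeg-resp-≈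
          (begin
            size true - side true u ≈⟨ +-cong (≈-trans (reflexive (≡.cong weight (≡.sym (cv ≡.refl)))) (zero-vector v))
                                              (-‿cong (reflexive (≡.cong (λ b → if b then 1# else 0#) (cu ≡.refl)))) ⟩
            0# - 1#                 ≈⟨ +-identityˡ _ ⟩
            - 1#                    ∎)
          (gap (term-≤-sum (side-nonNeg true) u)))

    -- Comparison with the square root of the number of edges.

    module Bound (connected : Connected G) {r : ℕ} (1≤r : 1 ℕ.≤ r) (free : BookFree (r ℕ.+ 1) G)
        (81r²≤m : (9 ℕ.* r) ℕ.^ 2 ℕ.≤ m)
        {√m : Carrier} (√m≥0 : NonNeg √m) (√m² : √m * √m ≈ ι m) where

      9r≤√m : ι 9 * ι r ≤ √m
      9r≤√m = square-cancel-≤ (NonNeg-* (NonNeg-ι 9) (NonNeg-ι r)) √m≥0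
        (≤-resp square (≈-sym √m²) (ι-mono 81r²≤m))
        where
        square : ι ((9 ℕ.* r) ℕ.^ 2) ≈ (ι 9 * ι r) * (ι 9 * ι r)
        square = begin
          ι ((9 ℕ.* r) ℕ.* ((9 ℕ.* r) ℕ.* 1))
            ≡⟨ ≡.cong (λ k → ι ((9 ℕ.* r) ℕ.* k)) (ℕ.*-identityʳ (9 ℕ.* r)) ⟩
          ι ((9 ℕ.* r) ℕ.* (9 ℕ.* r))
            ≈⟨ ×1-homo-* (9 ℕ.* r) (9 ℕ.* r) ⟩
          ι (9 ℕ.* r) * ι (9 ℕ.* r)
            ≈⟨ *-cong (×1-homo-* 9 r) (×1-homo-* 9 r) ⟩
          (ι 9 * ι r) * (ι 9 * ι r) ∎

      -- The estimates need `ρ ≥ 9r`. If `√m ≤ ρ`, this follows from `9r ≤ √m`; in the other case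
      -- the claim is already there.
      eigenvalue≤√m : ∀ {A ρ z} → (∀ i j → A i j ≡ a i j) → IsEigenvector A ρ z → ρ ≤ √m
      eigenvalue≤√m {ρ = ρ} A≡a eigen′ = ≤-cases {√m} {ρ}
        (λ √m≤ρ → let open Spectral connected 1≤r free (gap (≤-trans 9r≤√m √m≤ρ)) eigen in
          square-cancel-≤ ρ≥0 √m≥0 (≤-trans ρ²≤m (≤-reflexive (≈-sym √m²))))
        id
        where eigen = eigenvector-cong A≡a eigen′

      eigenvalue≈√m⇒completeBipartite : ∀ {A ρ z} → (∀ i j → A i j ≡ a i j) →
        IsEigenvector A ρ z → ρ ≈ √m → CompleteBipartite G
      eigenvalue≈√m⇒completeBipartite {ρ = ρ} A≡a eigen′ ρ≈√m = equality⇒completeBipartite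
        (proj₂ (proj₂ (edge-exists G 0<m)))
        (≤-reflexive (≈-trans (≈-sym √m²) (≈-sym (*-cong ρ≈√m ρ≈√m))))
        where
        0<m : 0 ℕ.< m
        0<m = ℕ.<-≤-trans (ℕ.m^n>0 (9 ℕ.* r)
          {{ℕ.>-nonZero (ℕ.<-≤-trans (ℕ.s≤s ℕ.z≤n) (ℕ.*-monoʳ-≤ 9 1≤r))}} 2) 81r²≤m
        open Spectral connected 1≤r free
          (gap (≤-trans 9r≤√m (≤-reflexive (≈-sym ρ≈√m)))) (eigenvector-cong A≡a eigen′)

-- The reals as a commutative ring.

module Reals where
  open Defs
  open ≡ using (refl; sym; trans; cong; subst; subst₂)

  Eventually : (ℕ → Set) → Set
  Eventually P = ∃[ N ] (∀ n → N ℕ.≤ n → P n)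

  eventually-map : ∀ {P Q : ℕ → Set} → (∀ n → P n → Q n) → Eventually P → Eventually Q
  eventually-map f (N , p) = N , λ n n≥ → f n (p n n≥)

  eventually-map₂ : ∀ {P Q R : ℕ → Set} → (∀ n → P n → Q n → R n) →
                    Eventually P → Eventually Q → Eventually R
  eventually-map₂ f (M , p) (N , q) = M ⊔ N , λ n n≥ →
    f n (p n (ℕ.m⊔n≤o⇒m≤o M N n≥)) (q n (ℕ.m⊔n≤o⇒n≤o M N n≥))

  halves : ∀ ε → ½ ℚ.* ε ℚ.+ ½ ℚ.* ε ≡ ε
  halves ε = trans (sym (ℚ.*-distribʳ-+ ε ½ ½)) (ℚ.*-identityˡ ε)

  ∣p∣<ε : ∀ {p ε} → p ℚ.< ε → ℚ.- p ℚ.< ε → ∣ p ∣ ℚ.< ε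
  ∣p∣<ε {p} p< -p< with ℚ.∣p∣≡p∨∣p∣≡-p p
  ... | inj₁ e = subst (ℚ._< _) (sym e) p<
  ... | inj₂ e = subst (ℚ._< _) (sym e) -p<

  p≤∣p∣ : ∀ p → p ℚ.≤ ∣ p ∣
  p≤∣p∣ p with ℚ.≤-total 0ℚ p
  ... | inj₁ 0≤p = ℚ.≤-reflexive (sym (ℚ.0≤p⇒∣p∣≡p 0≤p))
  ... | inj₂ p≤0 = ℚ.≤-trans p≤0 (ℚ.0≤∣p∣ p)

  -p≤∣p∣ : ∀ p → ℚ.- p ℚ.≤ ∣ p ∣
  -p≤∣p∣ p = subst (ℚ.- p ℚ.≤_) (ℚ.∣-p∣≡∣p∣ p) (p≤∣p∣ (ℚ.- p))

  neg-involutive : ∀ p → ℚ.- (ℚ.- p) ≡ p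
  neg-involutive = solve 1 (λ p → :- (:- p) := p) refl
    where open +-*-Solver

  shift-< : ∀ {p q} r → p ℚ.< q → p ℚ.+ r ℚ.< q ℚ.+ r
  shift-< r = ℚ.+-monoˡ-< r

  ≡⇒≃ : ∀ {x y} → (∀ n → seq x n ≡ seq y n) → x ≃ y
  ≡⇒≃ {x} {y} e ε 0<ε = 0 , λ n _ → subst (ℚ._< ε)
    (sym (cong ∣_∣ (trans (cong (ℚ._- seq y n) (e n)) (ℚ.+-inverseʳ (seq y n))))) 0<ε

  ≃-sym : ∀ {x y} → x ≃ y → y ≃ x
  ≃-sym {x} {y} e ε 0<ε = eventually-map (λ n → subst (ℚ._< ε)
    (trans (sym (ℚ.∣-p∣≡∣p∣ _)) (cong ∣_∣ (solve 2 (λ x y → :- (x :- y) := y :- x) refl (seq x n) (seq y n)))))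
    (e ε 0<ε)
    where open +-*-Solver

  ≃-trans : ∀ {x y z} → x ≃ y → y ≃ z → x ≃ z
  ≃-trans {x} {y} {z} e f ε 0<ε = eventually-map₂ (λ n p q → begin-strict
      ∣ seq x n ℚ.- seq z n ∣
        ≡⟨ cong ∣_∣ (solve 3 (λ x y z → x :- z := (x :- y) :+ (y :- z)) refl (seq x n) (seq y n) (seq z n)) ⟩
      ∣ (seq x n ℚ.- seq y n) ℚ.+ (seq y n ℚ.- seq z n) ∣
        ≤⟨ ℚ.∣p+q∣≤∣p∣+∣q∣ (seq x n ℚ.- seq y n) (seq y n ℚ.- seq z n) ⟩
      ∣ seq x n ℚ.- seq y n ∣ ℚ.+ ∣ seq y n ℚ.- seq z n ∣
        <⟨ ℚ.+-mono-< p q ⟩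
      ½ ℚ.* ε ℚ.+ ½ ℚ.* ε
        ≡⟨ halves ε ⟩
      ε ∎)
    (e _ (½>0 0<ε)) (f _ (½>0 0<ε))
    where
    open ℚ.≤-Reasoning
    open +-*-Solver

  +-cong : ∀ {x x′ y y′} → x ≃ x′ → y ≃ y′ → x + y ≃ x′ + y′
  +-cong {x} {x′} {y} {y′} e f ε 0<ε = eventually-map₂ (λ n p q → begin-strict
      ∣ (seq x n ℚ.+ seq y n) ℚ.- (seq x′ n ℚ.+ seq y′ n) ∣
        ≡⟨ cong ∣_∣ (+-difference (seq x n) (seq y n) (seq x′ n) (seq y′ n)) ⟩
      ∣ (seq x n ℚ.- seq x′ n) ℚ.+ (seq y n ℚ.- seq y′ n) ∣
        ≤⟨ ℚ.∣p+q∣≤∣p∣+∣q∣ (seq x n ℚ.- seq x′ n) (seq y n ℚ.- seq y′ n) ⟩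
      ∣ seq x n ℚ.- seq x′ n ∣ ℚ.+ ∣ seq y n ℚ.- seq y′ n ∣
        <⟨ ℚ.+-mono-< p q ⟩
      ½ ℚ.* ε ℚ.+ ½ ℚ.* ε
        ≡⟨ halves ε ⟩
      ε ∎)
    (e _ (½>0 0<ε)) (f _ (½>0 0<ε))
    where open ℚ.≤-Reasoning

  BoundOf : ℝ → Set
  BoundOf x = ∃[ B ] (ℚ.Positive B × Eventually (λ n → ∣ seq x n ∣ ℚ.≤ B))

  *-cong : ∀ {x x′ y y′} → x ≃ x′ → y ≃ y′ → x * y ≃ x′ * y′
  *-cong {x} {x′} {y} {y′} e f ε 0<ε = go (bounded (cauchy x)) (bounded (cauchy y′))
    where
    Goal : ℚ → Set
    Goal ε = Eventually (λ n → ∣ seq x n ℚ.* seq y n ℚ.- seq x′ n ℚ.* seq y′ n ∣ ℚ.< ε)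
    go : BoundOf x → BoundOf y′ → Goal ε
    go (A , A>0 , x≤A) (B , B>0 , y′≤B) = finish (divide (A ℚ.+ B) ε 0<ε)
      where
      instance _ = ℚ.pos+pos⇒pos A {{A>0}} B {{B>0}}
      close : ∀ δ → 0ℚ ℚ.< δ → Goal ((A ℚ.+ B) ℚ.* δ)
      close δ 0<δ = eventually-map₂ (λ n (x≤ , y′≤) (p , q) →
          product-close A B {{A>0}} {{B>0}} δ (seq x n) (seq y n) (seq x′ n) (seq y′ n) x≤ y′≤ p q)
        (eventually-map₂ (λ _ → _,_) x≤A y′≤B)
        (eventually-map₂ (λ _ → _,_) (e δ 0<δ) (f δ 0<δ))
      finish : ∃[ δ ] (0ℚ ℚ.< δ × (A ℚ.+ B) ℚ.* δ ≡ ε) → Goal ε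
      finish (δ , 0<δ , eq) = subst Goal eq (close δ 0<δ)

  infix 8 -_
  -_ : ℝ → ℝ
  - x = mkℝ (λ n → ℚ.- seq x n) λ ε 0<ε → negate ε (cauchy x ε 0<ε)
    where
    open +-*-Solver
    negate : ∀ ε → ∃[ N ] (∀ m n → N ℕ.≤ m → N ℕ.≤ n → ∣ seq x m ℚ.- seq x n ∣ ℚ.< ε) →
             ∃[ N ] (∀ m n → N ℕ.≤ m → N ℕ.≤ n → ∣ ℚ.- seq x m ℚ.- ℚ.- seq x n ∣ ℚ.< ε)
    negate ε (N , p) = N , λ m n m≥ n≥ → subst (ℚ._< ε)
      (trans (sym (ℚ.∣-p∣≡∣p∣ _)) (cong ∣_∣
        (solve 2 (λ x y → :- (x :- y) := :- x :- :- y) refl (seq x m) (seq x n))))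
      (p m n m≥ n≥)

  neg-cong : ∀ {x y} → x ≃ y → - x ≃ - y
  neg-cong {x} {y} e ε 0<ε = eventually-map (λ n → subst (ℚ._< ε)
    (trans (sym (ℚ.∣-p∣≡∣p∣ _)) (cong ∣_∣
      (solve 2 (λ x y → :- (x :- y) := :- x :- :- y) refl (seq x n) (seq y n)))))
    (e ε 0<ε)
    where open +-*-Solver

  ℝ-commutativeRing : CommutativeRing 0ℓ 0ℓ
  ℝ-commutativeRing = record
    { Carrier = ℝ ; _≈_ = _≃_ ; _+_ = _+_ ; _*_ = _*_ ; -_ = -_ ; 0# = 0ℝ ; 1# = 1ℝ
    ; isCommutativeRing = record
      { isRing = record
        { +-isAbelianGroup = record
          { isGroup = record
            { isMonoid = record
              { isSemigroup = record
                { isMagma = record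
                  { isEquivalence = record
                    { refl  = λ {x} → ≡⇒≃ {x} {x} (λ _ → refl)
                    ; sym   = λ {x} {y} → ≃-sym {x} {y}
                    ; trans = λ {x} {y} {z} → ≃-trans {x} {y} {z}
                    }
                  ; ∙-cong = λ {x} {x′} {y} {y′} → +-cong {x} {x′} {y} {y′}
                  }
                ; assoc = λ x y z → ≡⇒≃ {(x + y) + z} {x + (y + z)}
                    λ n → ℚ.+-assoc (seq x n) (seq y n) (seq z n)
                }
              ; identity = (λ x → ≡⇒≃ {0ℝ + x} {x} λ n → ℚ.+-identityˡ (seq x n))
                         , (λ x → ≡⇒≃ {x + 0ℝ} {x} λ n → ℚ.+-identityʳ (seq x n))
              }
            ; inverse = (λ x → ≡⇒≃ {(- x) + x} {0ℝ} λ n → ℚ.+-inverseˡ (seq x n))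
                      , (λ x → ≡⇒≃ {x + (- x)} {0ℝ} λ n → ℚ.+-inverseʳ (seq x n))
            ; ⁻¹-cong = λ {x} {y} → neg-cong {x} {y}
            }
          ; comm = λ x y → ≡⇒≃ {x + y} {y + x} λ n → ℚ.+-comm (seq x n) (seq y n)
          }
        ; *-cong = λ {x} {x′} {y} {y′} → *-cong {x} {x′} {y} {y′}
        ; *-assoc = λ x y z → ≡⇒≃ {(x * y) * z} {x * (y * z)}
            λ n → ℚ.*-assoc (seq x n) (seq y n) (seq z n)
        ; *-identity = (λ x → ≡⇒≃ {1ℝ * x} {x} λ n → ℚ.*-identityˡ (seq x n))
                     , (λ x → ≡⇒≃ {x * 1ℝ} {x} λ n → ℚ.*-identityʳ (seq x n))
        ; distrib = (λ x y z → ≡⇒≃ {x * (y + z)} {x * y + x * z}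
                       λ n → ℚ.*-distribˡ-+ (seq x n) (seq y n) (seq z n))
                  , (λ x y z → ≡⇒≃ {(y + z) * x} {y * x + z * x}
                       λ n → ℚ.*-distribʳ-+ (seq x n) (seq y n) (seq z n))
        }
      ; *-comm = λ x y → ≡⇒≃ {x * y} {y * x} λ n → ℚ.*-comm (seq x n) (seq y n)
      }
    }

  -- The order of the reals and its double-negation laws.

  module _ where
    open ℚ.≤-Reasoning
    open +-*-Solver

    near : ∀ {a b δ} → ∣ a ℚ.- b ∣ ℚ.< δ → b ℚ.< a ℚ.+ δ
    near {a} {b} {δ} p = begin-strict
      b                     ≡⟨ solve 2 (λ a b → b := a :+ :- (a :- b)) refl a b ⟩
      a ℚ.+ ℚ.- (a ℚ.- b)   ≤⟨ ℚ.+-monoʳ-≤ a (-p≤∣p∣ (a ℚ.- b)) ⟩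
      a ℚ.+ ∣ a ℚ.- b ∣     <⟨ ℚ.+-monoʳ-< a p ⟩
      a ℚ.+ δ               ∎

    NonNeg-resp : ∀ {x y} → x ≃ y → 0ℝ ≤ x → 0ℝ ≤ y
    NonNeg-resp {x} {y} e p ε 0<ε = eventually-map₂ (λ n p q → begin-strict
        0ℚ                              <⟨ p ⟩
        seq x n ℚ.+ ½ ℚ.* ε             <⟨ shift-< (½ ℚ.* ε) (near {seq y n} {seq x n} q) ⟩
        seq y n ℚ.+ ½ ℚ.* ε ℚ.+ ½ ℚ.* ε ≡⟨ ℚ.+-assoc (seq y n) (½ ℚ.* ε) (½ ℚ.* ε) ⟩
        seq y n ℚ.+ (½ ℚ.* ε ℚ.+ ½ ℚ.* ε) ≡⟨ cong (seq y n ℚ.+_) (halves ε) ⟩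
        seq y n ℚ.+ ε ∎)
      (p _ (½>0 0<ε)) (≃-sym {x} {y} e _ (½>0 0<ε))

    NonNeg-sum : ∀ {x y} → 0ℝ ≤ x → 0ℝ ≤ y → 0ℝ ≤ x + y
    NonNeg-sum {x} {y} p q ε 0<ε = eventually-map₂ (λ n p q → begin-strict
        0ℚ                          <⟨ ℚ.+-mono-< p q ⟩
        (seq x n ℚ.+ ½ ℚ.* ε) ℚ.+ (seq y n ℚ.+ ½ ℚ.* ε)
          ≡⟨ solve 3 (λ x y e → (x :+ e) :+ (y :+ e) := x :+ y :+ (e :+ e)) refl (seq x n) (seq y n) (½ ℚ.* ε) ⟩
        seq x n ℚ.+ seq y n ℚ.+ (½ ℚ.* ε ℚ.+ ½ ℚ.* ε)
          ≡⟨ cong (seq x n ℚ.+ seq y n ℚ.+_) (halves ε) ⟩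
        seq x n ℚ.+ seq y n ℚ.+ ε ∎)
      (p _ (½>0 0<ε)) (q _ (½>0 0<ε))

    private
      *-pos : ∀ {p q} → 0ℚ ℚ.< p → 0ℚ ℚ.< q → 0ℚ ℚ.< p ℚ.* q
      *-pos {p} {q} p>0 q>0 = ℚ.positive⁻¹ _ {{ℚ.pos*pos⇒pos p {{ℚ.positive p>0}} q {{ℚ.positive q>0}}}}

      *-nonNeg : ∀ {p q} → 0ℚ ℚ.≤ p → 0ℚ ℚ.≤ q → 0ℚ ℚ.≤ p ℚ.* q
      *-nonNeg {p} {q} p≥0 q≥0 = ℚ.nonNegative⁻¹ _
        {{ℚ.nonNeg*nonNeg⇒nonNeg p {{ℚ.nonNegative p≥0}} q {{ℚ.nonNegative q≥0}}}}

    -- a b = (a + δ)(b + δ) + (B − a) δ + (B − b) δ − (2B + δ) δ, of which only the last term can be negative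
    product-≥ : ∀ B δ a b → 0ℚ ℚ.< δ → δ ℚ.≤ 1ℚ → 0ℚ ℚ.< a ℚ.+ δ → 0ℚ ℚ.< b ℚ.+ δ →
      a ℚ.≤ B → b ℚ.≤ B → 0ℚ ℚ.< a ℚ.* b ℚ.+ (B ℚ.+ B ℚ.+ 1ℚ) ℚ.* δ
    product-≥ B δ a b δ>0 δ≤1 a> b> a≤ b≤ = begin-strict
      0ℚ
        <⟨ *-pos a> b> ⟩
      (a ℚ.+ δ) ℚ.* (b ℚ.+ δ)
        ≡⟨ ℚ.+-identityʳ _ ⟨
      (a ℚ.+ δ) ℚ.* (b ℚ.+ δ) ℚ.+ 0ℚ
        ≤⟨ ℚ.+-monoʳ-≤ ((a ℚ.+ δ) ℚ.* (b ℚ.+ δ))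
             (*-nonNeg {p = (B ℚ.- a) ℚ.+ (B ℚ.- b) ℚ.+ (1ℚ ℚ.- δ)} {q = δ}
               (ℚ.+-mono-≤ (ℚ.+-mono-≤ (diff a≤) (diff b≤)) (diff δ≤1)) (ℚ.<⇒≤ δ>0)) ⟩
      (a ℚ.+ δ) ℚ.* (b ℚ.+ δ) ℚ.+ ((B ℚ.- a) ℚ.+ (B ℚ.- b) ℚ.+ (1ℚ ℚ.- δ)) ℚ.* δ
        ≡⟨ solve 4 (λ a b B δ → (a :+ δ) :* (b :+ δ) :+ ((B :- a) :+ (B :- b) :+ (con 1ℚ :- δ)) :* δ
             := a :* b :+ (B :+ B :+ con 1ℚ) :* δ) refl a b B δ ⟩
      a ℚ.* b ℚ.+ (B ℚ.+ B ℚ.+ 1ℚ) ℚ.* δ ∎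
      where
      diff : ∀ {p q} → p ℚ.≤ q → 0ℚ ℚ.≤ q ℚ.- p
      diff {p} {q} p≤q = subst (ℚ._≤ q ℚ.- p) (ℚ.+-inverseʳ p) (ℚ.+-monoˡ-≤ (ℚ.- p) p≤q)

    NonNeg-product : ∀ {x y} → 0ℝ ≤ x → 0ℝ ≤ y → 0ℝ ≤ x * y
    NonNeg-product {x} {y} p q ε 0<ε = go (bounded (cauchy x)) (bounded (cauchy y))
      where
      Goal : ℚ → Set
      Goal ε = Eventually (λ n → 0ℚ ℚ.< seq x n ℚ.* seq y n ℚ.+ ε)
      grow : ∀ a b → 0ℚ ℚ.≤ b → a ℚ.≤ a ℚ.+ b
      grow a b b≥0 = subst (ℚ._≤ a ℚ.+ b) (ℚ.+-identityʳ a) (ℚ.+-monoʳ-≤ a b≥0)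
      go : BoundOf x → BoundOf y → Goal ε
      go (A , A>0 , x≤A) (B , B>0 , y≤B) = finish (divide C {{C>0}} ε 0<ε)
        where
        A+B C : ℚ
        A+B = A ℚ.+ B
        C = A+B ℚ.+ A+B ℚ.+ 1ℚ
        A+B>0 : ℚ.Positive A+B
        A+B>0 = ℚ.pos+pos⇒pos A {{A>0}} B {{B>0}}
        C>0 : ℚ.Positive C
        C>0 = ℚ.pos+pos⇒pos (A+B ℚ.+ A+B) {{ℚ.pos+pos⇒pos A+B {{A+B>0}} A+B {{A+B>0}}}} 1ℚ
        x≤A+B : ∀ {x} → ∣ x ∣ ℚ.≤ A → x ℚ.≤ A+B
        x≤A+B {x} x≤ = ℚ.≤-trans (p≤∣p∣ x) (ℚ.≤-trans x≤ (grow A B (ℚ.<⇒≤ (ℚ.positive⁻¹ B {{B>0}}))))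
        y≤A+B : ∀ {y} → ∣ y ∣ ℚ.≤ B → y ℚ.≤ A+B
        y≤A+B {y} y≤ = ℚ.≤-trans (p≤∣p∣ y) (ℚ.≤-trans y≤
          (subst (B ℚ.≤_) (ℚ.+-comm B A) (grow B A (ℚ.<⇒≤ (ℚ.positive⁻¹ A {{A>0}})))))
        close : ∀ δ → 0ℚ ℚ.< δ → δ ℚ.≤ 1ℚ → Goal (C ℚ.* δ)
        close δ 0<δ δ≤1 = eventually-map₂
          (λ n (x≤ , y≤) (x> , y>) → product-≥ A+B δ (seq x n) (seq y n) 0<δ δ≤1 x> y> (x≤A+B x≤) (y≤A+B y≤))
          (eventually-map₂ (λ _ → _,_) x≤A y≤B)
          (eventually-map₂ (λ _ → _,_) (p δ 0<δ) (q δ 0<δ))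
        finish : ∃[ δ ] (0ℚ ℚ.< δ × C ℚ.* δ ≡ ε) → Goal ε
        finish (δ , 0<δ , eq) with ℚ.≤-total δ 1ℚ
        ... | inj₁ δ≤1 = subst Goal eq (close δ 0<δ δ≤1)
        -- `product-≥` needs `δ ≤ 1`. A larger `δ` is replaced by 1, since then `C ≤ C δ = ε`.
        ... | inj₂ 1≤δ = eventually-map (λ n x> → ℚ.<-≤-trans x> (ℚ.+-monoʳ-≤ (seq x n ℚ.* seq y n)
                (subst (C ℚ.* 1ℚ ℚ.≤_) eq (ℚ.*-monoˡ-≤-nonNeg C {{ℚ.pos⇒nonNeg C {{C>0}}}} 1≤δ))))
                (close 1ℚ (ℚ.positive⁻¹ 1ℚ) ℚ.≤-refl)

    -- Comparing at a single Cauchy index decides the sign up to ε, which makes the order stable.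
    compare : ∀ x {ε} → 0ℚ ℚ.< ε →
      Eventually (λ n → 0ℚ ℚ.< seq x n ℚ.+ ε) ⊎ Eventually (λ n → seq x n ℚ.< ℚ.- (½ ℚ.* (½ ℚ.* ε)))
    compare x {ε} 0<ε with cauchy x _ (½>0 (½>0 0<ε))
    ... | N , close with ℚ.- (½ ℚ.* ε) ℚ.<? seq x N
    ...   | yes -ε/2<x = inj₁ (N , λ n n≥ → begin-strict
      0ℚ                                   ≤⟨ ℚ.<⇒≤ (½>0 (½>0 0<ε)) ⟩
      ½ ℚ.* (½ ℚ.* ε)
        ≡⟨ solve 1 (λ e → con ½ :* (con ½ :* e) := :- (con ½ :* e) :+ (e :- con ½ :* (con ½ :* e))) refl ε ⟩
      ℚ.- (½ ℚ.* ε) ℚ.+ (ε ℚ.- ½ ℚ.* (½ ℚ.* ε))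
        <⟨ shift-< (ε ℚ.- ½ ℚ.* (½ ℚ.* ε)) -ε/2<x ⟩
      seq x N ℚ.+ (ε ℚ.- ½ ℚ.* (½ ℚ.* ε))
        <⟨ shift-< (ε ℚ.- ½ ℚ.* (½ ℚ.* ε)) (near {seq x n} {seq x N} (close n N n≥ ℕ.≤-refl)) ⟩
      seq x n ℚ.+ ½ ℚ.* (½ ℚ.* ε) ℚ.+ (ε ℚ.- ½ ℚ.* (½ ℚ.* ε))
        ≡⟨ solve 3 (λ x e d → x :+ d :+ (e :- d) := x :+ e) refl (seq x n) ε (½ ℚ.* (½ ℚ.* ε)) ⟩
      seq x n ℚ.+ ε ∎)
    ...   | no ≮ = inj₂ (N , λ n n≥ → begin-strict
      seq x n
        <⟨ near {seq x N} {seq x n} (close N n ℕ.≤-refl n≥) ⟩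
      seq x N ℚ.+ ½ ℚ.* (½ ℚ.* ε)
        ≤⟨ ℚ.+-monoˡ-≤ (½ ℚ.* (½ ℚ.* ε)) (ℚ.≮⇒≥ ≮) ⟩
      ℚ.- (½ ℚ.* ε) ℚ.+ ½ ℚ.* (½ ℚ.* ε)
        ≡⟨ solve 1 (λ e → :- (con ½ :* e) :+ con ½ :* (con ½ :* e) := :- (con ½ :* (con ½ :* e))) refl ε ⟩
      ℚ.- (½ ℚ.* (½ ℚ.* ε)) ∎)

    clash : ∀ {P Q : ℕ → Set} → Eventually P → Eventually Q → ∃[ n ] (P n × Q n)
    clash (M , p) (N , q) = M ⊔ N , p _ (ℕ.m≤m⊔n M N) , q _ (ℕ.m≤n⊔m M N)

    below⇒¬NonNeg : ∀ x {δ} → 0ℚ ℚ.< δ → Eventually (λ n → seq x n ℚ.< ℚ.- δ) → ¬ (0ℝ ≤ x)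
    below⇒¬NonNeg x {δ} 0<δ below p with clash below (p δ 0<δ)
    ... | n , x< , x> = ℚ.<-asym x> (subst (seq x n ℚ.+ δ ℚ.<_) (ℚ.+-inverseˡ δ) (shift-< δ x<))

    NonNeg-stable : ∀ {x} → ¬ ¬ (0ℝ ≤ x) → 0ℝ ≤ x
    NonNeg-stable {x} nn ε 0<ε with compare x 0<ε
    ... | inj₁ p = p
    ... | inj₂ q = contradiction (below⇒¬NonNeg x (½>0 (½>0 0<ε)) q) nn

    -- If there were no gap `δ`, `compare` would end in its first alternative for every `ε`, which
    -- is `0ℝ ≤ x`.
    separated : ∀ {x} → ¬ (0ℝ ≤ x) → ¬ ¬ (∃[ δ ] (0ℚ ℚ.< δ × Eventually (λ n → seq x n ℚ.< ℚ.- δ)))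
    separated {x} n k = n λ ε 0<ε → [ (λ p → p) , (λ q → contradiction (_ , ½>0 (½>0 0<ε) , q) k) ]′ (compare x 0<ε)

    below⇒NonNeg-neg : ∀ x {δ} → 0ℚ ℚ.< δ → Eventually (λ n → seq x n ℚ.< ℚ.- δ) → 0ℝ ≤ - x
    below⇒NonNeg-neg x {δ} 0<δ below ε 0<ε = eventually-map (λ n x< → ℚ.+-mono-<
        (ℚ.<-trans 0<δ (subst (ℚ._< ℚ.- seq x n) (neg-involutive δ) (ℚ.neg-antimono-< x<))) 0<ε) below

    NonNeg-total : ∀ {x} → ¬ (0ℝ ≤ x) → 0ℝ ≤ - x
    NonNeg-total {x} n = NonNeg-stable {x = - x} λ k → separated {x} n λ (δ , 0<δ , q) →
      k (below⇒NonNeg-neg x 0<δ q)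

    NonNeg-antisym : ∀ {x} → 0ℝ ≤ x → 0ℝ ≤ - x → x ≃ 0ℝ
    NonNeg-antisym {x} p q ε 0<ε = eventually-map₂ (λ n p q → subst (λ z → ∣ z ∣ ℚ.< ε)
        (sym (ℚ.+-identityʳ (seq x n)))
        (∣p∣<ε (subst (ℚ._< ε) (neg-involutive (seq x n)) (-p<ε (ℚ.- seq x n) q)) (-p<ε (seq x n) p)))
      (p ε 0<ε) (q ε 0<ε)
      where
      -p<ε : ∀ p → 0ℚ ℚ.< p ℚ.+ ε → ℚ.- p ℚ.< ε
      -p<ε p 0<p+ε = begin-strict
        ℚ.- p               ≡⟨ ℚ.+-identityʳ (ℚ.- p) ⟨
        ℚ.- p ℚ.+ 0ℚ        <⟨ ℚ.+-monoʳ-< (ℚ.- p) 0<p+ε ⟩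
        ℚ.- p ℚ.+ (p ℚ.+ ε) ≡⟨ solve 2 (λ p e → :- p :+ (p :+ e) := e) refl p ε ⟩
        ε                   ∎

    -- The goal is stable, so both negated inequalities may be given margins: `x < −δ` and `c > η`
    -- eventually, hence `x c < −δη`, contradicting `0 ≤ x c`.
    NonNeg-cancel : ∀ {x c} → ¬ (0ℝ ≤ - c) → 0ℝ ≤ x * c → 0ℝ ≤ x
    NonNeg-cancel {x} {c} c>0 p = NonNeg-stable {x} λ x<0 →
      separated {x} x<0 λ (δ , 0<δ , x<) → separated {x = - c} c>0 λ (η , 0<η , c<) →
      below⇒¬NonNeg (x * c) (*-pos 0<δ 0<η) (eventually-map₂ (λ n → product n δ η 0<δ 0<η) x< c<) p
      where
      product : ∀ n δ η → 0ℚ ℚ.< δ → 0ℚ ℚ.< η → seq x n ℚ.< ℚ.- δ → ℚ.- seq c n ℚ.< ℚ.- η →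
                seq x n ℚ.* seq c n ℚ.< ℚ.- (δ ℚ.* η)
      product n δ η 0<δ 0<η x< c< = begin-strict
        seq x n ℚ.* seq c n
          ≡⟨ solve 2 (λ x c → x :* c := :- (:- x :* c)) refl (seq x n) (seq c n) ⟩
        ℚ.- (ℚ.- seq x n ℚ.* seq c n)
          <⟨ ℚ.neg-antimono-< (ℚ.<-trans
               (ℚ.*-monoʳ-<-pos δ {{ℚ.positive 0<δ}} η<c)
               (ℚ.*-monoˡ-<-pos (seq c n) {{ℚ.positive (ℚ.<-trans 0<η η<c)}} δ<-x)) ⟩
        ℚ.- (δ ℚ.* η) ∎
        where
        η<c : η ℚ.< seq c n
        η<c = subst₂ ℚ._<_ (neg-involutive η) (neg-involutive (seq c n)) (ℚ.neg-antimono-< c<)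
        δ<-x : δ ℚ.< ℚ.- seq x n
        δ<-x = subst (ℚ._< ℚ.- seq x n) (neg-involutive δ) (ℚ.neg-antimono-< x<)

    1-positive : ¬ (0ℝ ≤ - 1ℝ)
    1-positive p with p ½ (ℚ.positive⁻¹ ½)
    ... | N , q = ℚ.<-asym (q N ℕ.≤-refl) (ℚ.negative⁻¹ (ℚ.- 1ℚ ℚ.+ ½))

  ℝ-orderedRing : OrderedRing
  ℝ-orderedRing = record
    { commutativeRing = ℝ-commutativeRing
    ; NonNeg         = 0ℝ ≤_
    ; NonNeg-resp-≈  = λ {x} {y} → NonNeg-resp {x} {y}
    ; NonNeg-+       = λ {x} {y} → NonNeg-sum {x} {y}
    ; NonNeg-*       = λ {x} {y} → NonNeg-product {x} {y}
    ; NonNeg-stable  = λ {x} → NonNeg-stable {x}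
    ; NonNeg-total   = λ {x} → NonNeg-total {x}
    ; NonNeg-antisym = λ {x} → NonNeg-antisym {x}
    ; NonNeg-cancel  = λ {x} {c} → NonNeg-cancel {x} {c}
    ; 1-positive     = 1-positive
    }

  -- Agreement of numerals, orders and eigenvectors over the reals with the abstract ones.

  n/1 : ∀ n → ℤ.+ n ℚ./ 1 ≡ ℚ.mkℚ (ℤ.+ n) 0 (Coprimality.sym (1-coprimeTo n))
  n/1 n = ℚ.normalize-coprime (Coprimality.sym (1-coprimeTo n))

  suc/1 : ∀ n → ℤ.+ suc n ℚ./ 1 ≡ ℚ.1ℚ ℚ.+ ℤ.+ n ℚ./ 1
  suc/1 n = sym (trans (cong (ℚ.1ℚ ℚ.+_) (n/1 n))
    (cong (λ i → (ℤ.1ℤ ℤ.+ i) ℚ./ 1) (ℤ.*-identityʳ (ℤ.+ n))))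

  open OrderedRing ℝ-orderedRing using (+-congˡ; semiring)
    renaming (sym to ≈-sym)
  open OrderedRingProperties ℝ-orderedRing using (gap)
    renaming (ι to ιℝ; _≤_ to _⊑ℝ_; mk≤ to mk⊑)

  fromℕ≃ι : ∀ n → fromℕ n ≃ ιℝ n
  fromℕ≃ι zero    = ≡⇒≃ {fromℕ 0} {0ℝ} λ _ → refl
  fromℕ≃ι (suc n) = ≃-trans {fromℕ (suc n)} {1ℝ + fromℕ n} {ιℝ (suc n)}
    (≡⇒≃ {fromℕ (suc n)} {1ℝ + fromℕ n} λ _ → suc/1 n)
    (≃-trans {1ℝ + fromℕ n} {1ℝ + ιℝ n} {ιℝ (suc n)}
      (+-congˡ {1ℝ} {fromℕ n} {ιℝ n} (fromℕ≃ι n))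
      (≈-sym {ιℝ (suc n)} {1ℝ + ιℝ n} (1+× n 1ℝ)))
    where open import Algebra.Properties.Semiring.Mult.TCOptimised semiring using (1+×)

  ≤⇒⊑ : ∀ {x y} → x ≤ y → x ⊑ℝ y
  ≤⇒⊑ {x} {y} p = mk⊑ λ ε 0<ε → eventually-map (λ n q → subst₂ ℚ._<_
      (ℚ.+-inverseʳ (seq x n))
      (solve 3 (λ x y e → y :+ e :- x := y :- x :+ e) refl (seq x n) (seq y n) ε)
      (shift-< (ℚ.- seq x n) q))
    (p ε 0<ε)
    where open +-*-Solver using (solve; _:=_; _:+_; _:-_)

  ⊑⇒≤ : ∀ {x y} → x ⊑ℝ y → x ≤ y
  ⊑⇒≤ {x} {y} p ε 0<ε = eventually-map (λ n q → subst₂ ℚ._<_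
      (ℚ.+-identityˡ (seq x n))
      (solve 3 (λ x y e → y :- x :+ e :+ x := y :+ e) refl (seq x n) (seq y n) ε)
      (shift-< (seq x n) q))
    (gap p ε 0<ε)
    where open +-*-Solver using (solve; _:=_; _:+_; _:-_)

  module ℝ-Matrices = Matrices ℝ-orderedRing

  -- The matrix is arbitrary because at adjacencyMatrix G this conversion would unfold real products.
  eigenvalue⇒eigenvector : ∀ {n} (A : Matrix n) μ → ((x , _) : IsEigenvalue A μ) →
    ℝ-Matrices.IsEigenvector A μ x
  eigenvalue⇒eigenvector A μ (x , eigen) = eigen

  eigenvector⇒eigenvalue : ∀ {n} (A : Matrix n) μ x →
    ℝ-Matrices.IsEigenvector A μ x → IsEigenvalue A μ
  eigenvector⇒eigenvalue A μ x eigen = x , eigen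

-- The spectral radius of book-free graphs.

open Defs
open Reals
open OrderedRingProperties ℝ-orderedRing using (≤-antisym) renaming (ι to ιℝ; _≤_ to _⊑ℝ_)

theorem1p3 : ∀ (r : ℕ) → 1 ℕ.≤ r →
    ∀ {n : ℕ} (G : Graph n) → Connected G →
    (9 ℕ.* r) ℕ.^ 2 ℕ.≤ numEdges G →
    BookFree (r ℕ.+ 1) G →
    ∀ (ρ √m : ℝ) → IsSpectralRadius G ρ → IsSqrt (fromℕ (numEdges G)) √m →
    (ρ ≤ √m) × (ρ ≃ √m ⇔ CompleteBipartite G)
theorem1p3 r 1≤r {n} G connected 81r²≤m free ρ √m (eigenvalue@(z , _) , largest) (0≤√m , √m²) =
  ⊑⇒≤ {ρ} {√m} ρ⊑√m , mk⇔
    (eigenvalue≈√m⇒completeBipartite {adjacencyMatrix G} {ρ} {z} (λ _ _ → ≡.refl) eigen) bipartite⇒tight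
  where
  √m²≃ιm : √m * √m ≃ ιℝ (numEdges G)
  √m²≃ιm = ≃-trans {√m * √m} {fromℕ (numEdges G)} {ιℝ (numEdges G)} √m² (fromℕ≃ι (numEdges G))

  open ℝ-Matrices.Adjacency.Bound G connected 1≤r free 81r²≤m {√m} 0≤√m √m²≃ιm

  eigen : ℝ-Matrices.IsEigenvector (adjacencyMatrix G) ρ z
  eigen = eigenvalue⇒eigenvector (adjacencyMatrix G) ρ eigenvalue

  ρ⊑√m : ρ ⊑ℝ √m
  ρ⊑√m = eigenvalue≤√m {adjacencyMatrix G} {ρ} {z} (λ _ _ → ≡.refl) eigen

  -- `√m` is an eigenvalue of a complete bipartite graph, so maximality of `ρ` reverses the bound.
  bipartite⇒tight : CompleteBipartite G → ρ ≃ √m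
  bipartite⇒tight (c , onto , cut) = ≤-antisym {ρ} {√m} ρ⊑√m (≤⇒⊑ {√m} {ρ} (largest √m
    (eigenvector⇒eigenvalue (adjacencyMatrix G) √m vector (eigenvector {adjacencyMatrix G} (λ _ _ → ≡.refl)))))
    where open ℝ-Matrices.Adjacency.FromBipartite G c onto cut √m √m²≃ιm
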